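{- Let $0<\varepsilon<1$, let $P=D+\varepsilon$, let $\theta=D+\gamma\varepsilon-1$ for some $\gamma\in(1,\tfrac{1}{\varepsilon}]$, and let $$L_\theta=\{(u,v)\in E:\ \theta\le d(u)\le D \text{ and } d(u)+w(u,v)>D\}$$ be the set of relevant edges in the partial random model. Let $X=\sum_{e\in L_\theta}X_e$ be the total number of edges of $L_\theta$ that are pruned by Dijkstra-Prediction, where $X_e=1$ if $e$ is pruned and $X_e=0$ otherwise. Then $$\mathbf{E}[X]\ge\Big(1-\frac1\gamma\Big)|L_\theta|.$$ Further, if $(1-\frac1\gamma)|L_\theta|\ge 8\ln n$, then $$\mathbf{P}\Big(X\ge\tfrac12\big(1-\tfrac1\gamma\big)|L_\theta|\Big)\ge 1-\frac1n .$$
   Context: Setting: directed graph $G=(V,E)$ with $n=|V|$, edge weights $w(e)\in[0,1]$, source $s$, target set $T\subseteq V$ with some target reachable from $s$; $D$ is the minimum shortest path distance from $s$ to a node of $T$. Algorithm Dijkstra-Prediction (with prediction available from the start): Dijkstra's algorithm from $s$, stopped when the first target is removed from the priority queue, which additionally uses a fixed prediction $P=D+\varepsilon$ (where $\varepsilon\geq 0$ is the additive prediction error) and a bound $B$, equal at any time to the smallest tentative distance $d(u)+w(u,v)$ of a target $v\in T$ encountered so far (initially $B=\infty$). When a node $u$ has been removed from the queue, with final distance $d(u)$, each outgoing edge $(u,v)$ is scanned and its tentative distance $tent=d(u)+w(u,v)$ is computed; the edge is pruned (does not cause an operation on the priority queue) if $tent$ exceeds $B$ or $P$. Partial random model: an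 adversary fixes the set $Q=\{u_1,\dots,u_l\}$ of nodes removed from the priority queue, where $u_i$ is removed in iteration $i$, their distances $d(u_1)\le\dots\le d(u_l)$ (hence also $D$), and all outgoing edges of the nodes in $Q$; the adversary may also fix all other parts of the instance, except for the weights of the edges in $L_\theta$, which are random. Conditional on this configuration (in particular the set $L_\theta$ is fixed), the tentative distances $d(u)+w(u,v)$, $(u,v)\in L_\theta$, are independent and each is uniformly distributed on $[D,d(u)+1]$. All probabilities and expectations are with respect to this randomness. -}

module Defs where

open import Algebra.Bundles using (CommutativeRing; Semiring)
open import Algebra.Core using (Op₁)
import Algebra.Construct.NaturalChoice.Min as Min
import Algebra.Definitions.RawSemiring as RawSemiringDefs
open import Data.Bool.Base using (if_then_else_)
open import Data.Fin.Base using (Fin; toℕ)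
open import Data.Fin.Properties using (_≟_)
open import Data.Fin.Subset using (Subset; _∈_; _∉_; _∪_; ⁅_⁆) renaming (⊥ to ∅)
open import Data.Fin.Subset.Properties using (_∈?_)
open import Data.List.Base using (List; []; _∷_; map; foldl; foldr)
open import Data.List.Membership.DecPropositional using () renaming (_∈?_ to member?)
open import Data.List.Membership.Propositional using () renaming (_∈_ to _∈ˡ_; _∉_ to _∉ˡ_)
open import Data.List.Relation.Unary.All using (All)
open import Data.List.Relation.Unary.Unique.Propositional using (Unique)
open import Data.Maybe.Base using (Maybe; just; nothing)
open import Data.Nat.Base as ℕ using (ℕ; _!)
import Data.Nat.ListAction as ℕList
open import Data.Product.Base using (_×_; _,_; ∃-syntax)
open import Data.Product.Properties using (≡-dec)
open import Data.Vec.Functional using (updateAt)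
open import Function.Base using (_∘_)
open import Function.Bundles using (_⇔_)
open import Level using (0ℓ) renaming (suc to lsuc)
open import Relation.Binary.Bundles using (DecTotalOrder; StrictTotalOrder)
open import Relation.Binary.Core using (Rel)
open import Relation.Binary.Definitions using (DecidableEquality)
open import Relation.Binary.PropositionalEquality using (_≡_; _≢_)
import Relation.Binary.Properties.DecTotalOrder as DecTotalOrderProperties
open import Relation.Binary.Structures using (IsDecTotalOrder)
open import Relation.Nullary.Decidable.Core using (does; yes; no; _⊎-dec_) renaming (Dec to Decision)
open import Relation.Nullary.Negation.Core using (¬_)
open import Relation.Unary using (Pred; ∁; ⋃; _≐_; _⊥_; U)

------------------------------------------------------------------------
-- The real numbers

-- Complete ordered fields are unique up to isomorphism; "the reals" are
-- an arbitrary one.  The order is decidable because the mathematics is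
-- classical (and the algorithm below branches on comparisons).

record CompleteOrderedField : Set₁ where
  infix 4 _≤_
  infix 9 _⁻¹
  field
    commutativeRing : CommutativeRing 0ℓ 0ℓ

  open CommutativeRing commutativeRing public

  field
    _≤_             : Rel Carrier 0ℓ
    isDecTotalOrder : IsDecTotalOrder _≈_ _≤_
    0≉1             : ¬ 0# ≈ 1#
    +-monoˡ-≤       : ∀ {x y} z → x ≤ y → x + z ≤ y + z
    *-nonneg        : ∀ {x y} → 0# ≤ x → 0# ≤ y → 0# ≤ x * y
    -- The inverse of 0# is unspecified.
    _⁻¹             : Op₁ Carrier
    ⁻¹-inverseʳ     : ∀ x → ¬ x ≈ 0# → x * x ⁻¹ ≈ 1#
    supremum        : (S : Pred Carrier 0ℓ) →
                      ∃[ x ] S x →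
                      ∃[ b ] (∀ x → S x → x ≤ b) →
                      ∃[ b ] (∀ x → S x → x ≤ b) ×
                             (∀ c → (∀ x → S x → x ≤ c) → b ≤ c)

  decTotalOrder : DecTotalOrder 0ℓ 0ℓ 0ℓ
  decTotalOrder = record { isDecTotalOrder = isDecTotalOrder }

  open DecTotalOrder decTotalOrder public using (_≤?_; totalOrder)
  open DecTotalOrderProperties decTotalOrder public using (_<_; <-strictTotalOrder)
  open StrictTotalOrder <-strictTotalOrder public using (_<?_)
  open Min totalOrder public using (_⊓_)
  open RawSemiringDefs (Semiring.rawSemiring semiring) public using (_^_; sum) renaming (_×_ to _·_)

  fromℕ : ℕ → Carrier
  fromℕ k = k · 1#

module Analysis (ℝ : CompleteOrderedField) where
  open CompleteOrderedField ℝ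

  _⟶_ : (ℕ → Carrier) → Carrier → Set
  a ⟶ l = ∀ δ → 0# < δ → ∃[ N ] (∀ k → N ℕ.≤ k → l - δ < a k × a k < l + δ)

  HasSum : (ℕ → Carrier) → Carrier → Set
  HasSum a l = (λ N → sum {N} (a ∘ toℕ)) ⟶ l

  IsExp : Carrier → Carrier → Set
  IsExp x y = HasSum (λ k → x ^ k * fromℕ (k !) ⁻¹) y

  IsLn : Carrier → Carrier → Set
  IsLn y x = IsExp x y

  ∏ : List Carrier → Carrier
  ∏ = foldr _*_ 1#

  data Borel : Pred (Pred Carrier 0ℓ) (lsuc 0ℓ) where
    ray        : ∀ a → Borel (_≤ a)
    complement : ∀ {S} → Borel S → Borel (∁ S)
    union      : (S : ℕ → Pred Carrier 0ℓ) → (∀ k → Borel (S k)) → Borel (⋃ ℕ S)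
    respects   : ∀ {S S′} → S ≐ S′ → Borel S → Borel S′

------------------------------------------------------------------------
-- Probability

-- ℙ is applied to arbitrary predicates, but nothing is assumed about its
-- values outside the σ-algebra of measurable ones.

record ProbabilitySpace (ℝ : CompleteOrderedField) : Set₂ where
  open CompleteOrderedField ℝ
  open Analysis ℝ
  field
    Ω          : Set
    Measurable : Pred (Pred Ω 0ℓ) (lsuc 0ℓ)
    ℙ          : Pred Ω 0ℓ → Carrier

    universe   : Measurable U
    ∁-closed   : ∀ {A} → Measurable A → Measurable (∁ A)
    ⋃-closed   : (A : ℕ → Pred Ω 0ℓ) → (∀ k → Measurable (A k)) → Measurable (⋃ ℕ A)
    ≐-closed   : ∀ {A A′} → A ≐ A′ → Measurable A → Measurable A′

    ℙ-respects : ∀ {A A′} → Measurable A → A ≐ A′ → ℙ A ≈ ℙ A′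
    ℙ-nonneg   : ∀ {A} → Measurable A → 0# ≤ ℙ A
    ℙ-universe : ℙ U ≈ 1#
    ℙ-additive : (A : ℕ → Pred Ω 0ℓ) → (∀ k → Measurable (A k)) →
                 (∀ j k → j ≢ k → A j ⊥ A k) →
                 HasSum (ℙ ∘ A) (ℙ (⋃ ℕ A))

module Probability {ℝ : CompleteOrderedField} (𝒫 : ProbabilitySpace ℝ) where
  open CompleteOrderedField ℝ
  open Analysis ℝ
  open ProbabilitySpace 𝒫

  IsRandomVariable : (Ω → Carrier) → Set₁
  IsRandomVariable Y = ∀ S → Borel S → Measurable (S ∘ Y)

  record IsUniform (Y : Ω → Carrier) (a b : Carrier) : Set₁ where
    field
      isRandomVariable : IsRandomVariable Y
      distribution     : ∀ x → a ≤ x → x ≤ b →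
                         ℙ (λ ω → Y ω ≤ x) ≈ (x - a) * (b - a) ⁻¹

  -- Mutual independence of the variables indexed by the entries of a list.
  -- Sublists are covered by taking some of the S i to be the whole line.
  Independent : {I : Set} → List I → (I → Ω → Carrier) → Set₁
  Independent {I} is Y =
    (S : I → Pred Carrier 0ℓ) → (∀ i → Borel (S i)) →
    ℙ (λ ω → All (λ i → S i (Y i ω)) is) ≈ ∏ (map (λ i → ℙ (S i ∘ Y i)) is)

  record IsExpectation (X : Ω → ℕ) (μ : Carrier) : Set₁ where
    field
      measurable : ∀ k → Measurable (λ ω → X ω ≡ k)
      hasSum     : HasSum (λ k → fromℕ k * ℙ (λ ω → X ω ≡ k)) μ

------------------------------------------------------------------------
-- Networks

-- The edges are the pairs (u , v) with v in the adjacency list of u.  The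
-- order of an adjacency list is the order in which a search scans it.

record Network (n : ℕ) : Set where
  field
    out        : Fin n → List (Fin n)
    out-unique : ∀ u → Unique (out u)
    source     : Fin n
    targets    : Subset n

  Vertex : Set
  Vertex = Fin n

  Edge : Set
  Edge = Vertex × Vertex

  IsEdge : Pred Edge 0ℓ
  IsEdge (u , v) = v ∈ˡ out u

  _≟ₑ_ : DecidableEquality Edge
  _≟ₑ_ = ≡-dec _≟_ _≟_

module Search (ℝ : CompleteOrderedField) {n : ℕ} (G : Network n) where
  open CompleteOrderedField ℝ
  open Network G

  Weights : Set
  Weights = Vertex → Vertex → Carrier

  data Path (w : Weights) : Vertex → Vertex → Carrier → Set where
    []  : ∀ {u} → Path w u u 0#
    _∷_ : ∀ {u v t r} → IsEdge (u , v) → Path w v t r → Path w u t (w u v + r)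

  -- In particular, some target is reachable from the source.
  record IsTargetDistance (w : Weights) (D : Carrier) : Set where
    field
      attained : ∃[ t ] ∃[ r ] t ∈ targets × Path w source t r × r ≈ D
      minimal  : ∀ t r → t ∈ targets → Path w source t r → D ≤ r

  -- Carrier extended by ∞, which is represented by nothing.
  Carrier∞ : Set
  Carrier∞ = Maybe Carrier

  _⊓∞_ : Carrier → Carrier∞ → Carrier
  x ⊓∞ just y  = x ⊓ y
  x ⊓∞ nothing = x

  _>∞_ : Carrier → Carrier∞ → Set
  x >∞ y = ∃[ b ] y ≡ just b × b < x

  _>∞?_ : ∀ x y → Decision (x >∞ y)
  x >∞? nothing = no λ { (_ , () , _) }
  x >∞? just b with b <? x
  ... | yes b<x = yes (b , _≡_.refl , b<x)
  ... | no  b≮x = no λ { (_ , _≡_.refl , b<x) → b≮x b<x }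

  -- The priority queue consists of the vertices u ∉ removed with
  -- dist u ≢ nothing, and dist u is the key of such a vertex.
  record State : Set where
    field
      dist    : Vertex → Carrier∞
      removed : Subset n
      bound   : Carrier∞
      pruned  : List Edge

  open State public

  initial : State
  initial = record
    { dist    = updateAt (λ _ → nothing) source (λ _ → just 0#)
    ; removed = ∅
    ; bound   = nothing
    ; pruned  = []
    }

  record IsQueueMinimum (σ : State) (u : Vertex) (x : Carrier) : Set where
    field
      not-removed : u ∉ removed σ
      key         : dist σ u ≡ just x
      minimal     : ∀ v y → v ∉ removed σ → dist σ v ≡ just y → x ≤ y

  module DijkstraPrediction (P : Carrier) (w : Weights) where

    -- Lowering dist v inserts v into the queue or decreases its key; it is
    -- without effect (up to _≈_) if v was already removed.
    scanEdge : Vertex → Carrier → State → Vertex → State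
    scanEdge u x σ v = if does ((tent >∞? B) ⊎-dec (P <? tent))
        then record σ { bound = B ; pruned = (u , v) ∷ pruned σ }
        else record σ { bound = B ; dist = updateAt (dist σ) v (λ y → just (tent ⊓∞ y)) }
      where
      tent : Carrier
      tent = x + w u v

      B : Carrier∞
      B = if does (v ∈? targets) then just (tent ⊓∞ bound σ) else bound σ

    removeAndScan : Vertex → Carrier → State → State
    removeAndScan u x σ =
      foldl (scanEdge u x) (record σ { removed = removed σ ∪ ⁅ u ⁆ }) (out u)

    -- Run d σ us τ: started in σ, the search removes the vertices us in this
    -- order, with distances d, and ends in τ.  Ties between keys may be
    -- broken arbitrarily.  No vertex is removed after the first target;
    -- as for every removed vertex, the outgoing edges of that target are
    -- scanned.
    data Run (d : Vertex → Carrier) : State → List Vertex → State → Set where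
      stop : ∀ {σ u x} → IsQueueMinimum σ u x → x ≈ d u → u ∈ targets →
             Run d σ (u ∷ []) (removeAndScan u x σ)
      step : ∀ {σ u x us τ} → IsQueueMinimum σ u x → x ≈ d u → u ∉ targets →
             Run d (removeAndScan u x σ) us τ →
             Run d σ (u ∷ us) τ

------------------------------------------------------------------------
-- The partial random model

-- The probability space carries the law conditioned on the configuration
-- chosen by the adversary, so the latter is the same for all outcomes.

record PartialRandomModel {ℝ : CompleteOrderedField} (𝒫 : ProbabilitySpace ℝ)
                          {n : ℕ} (G : Network n)
                          (D P θ : CompleteOrderedField.Carrier ℝ) : Set₁ where
  open CompleteOrderedField ℝ
  open ProbabilitySpace 𝒫
  open Probability 𝒫
  open Network G
  open Search ℝ G
  open DijkstraPrediction P
  field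
    weights        : Ω → Weights
    weights-bounds : ∀ ω u v → IsEdge (u , v) → 0# ≤ weights ω u v × weights ω u v ≤ 1#
    targetDistance : ∀ ω → IsTargetDistance (weights ω) D

    -- Q lists u₁, …, u_l; d is only meaningful on Q.
    Q              : List Vertex
    d              : Vertex → Carrier
    final          : Ω → State
    run            : ∀ ω → Run (weights ω) d initial Q (final ω)

  tentative : Edge → Ω → Carrier
  tentative (u , v) ω = d u + weights ω u v

  Relevant : Ω → Pred Edge 0ℓ
  Relevant ω (u , v) = IsEdge (u , v) × u ∈ˡ Q × θ ≤ d u × d u ≤ D × D < tentative (u , v) ω

  field
    L_θ            : List Edge
    L_θ-unique     : Unique L_θ
    L_θ-relevant   : ∀ ω e → e ∈ˡ L_θ ⇔ Relevant ω e
    others-fixed   : ∀ u v → IsEdge (u , v) → (u , v) ∉ˡ L_θ → ∀ ω ω′ → weights ω u v ≈ weights ω′ u v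
    uniform        : ∀ u v → (u , v) ∈ˡ L_θ → IsUniform (tentative (u , v)) D (d u + 1#)
    independent    : Independent L_θ tentative

  prunedIndicator : Edge → Ω → ℕ
  prunedIndicator e ω = if does (member? _≟ₑ_ e (pruned (final ω))) then 1 else 0

  X : Ω → ℕ
  X ω = ℕList.sum (map (λ e → prunedIndicator e ω) L_θ)

{-# OPTIONS --safe #-}

-- An edge whose tentative distance exceeds P is pruned, so X dominates the
-- number Y of edges of L_θ with tentative distance above P.  As that
-- distance is uniform on an interval of length at least γε starting at D,
-- the event has probability at least p = 1 - 1/γ, which gives the
-- expectation.  For the tail let N = |L_θ|, so m = pN.  Independence and
-- Markov's inequality for 2^(-Y) yield
--   ℙ(Y ≤ r) ≤ 2^r (1 - p/2)^N,
-- and 1 - p/2 ≤ (1 - p/8)(1 - 3p/8).  Here n (1 - p/8)^N ≤ 1 because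
-- n = exp (ln n) with ln n ≤ pN/8, and 2^r (1 - 3p/8)^N ≤ 1 for r ≤ m/2
-- because 2 ≤ (9/8)^6.  The exponential function enters only through
-- partial sums of its series.
--
-- X is measurable because the order in which edges are scanned is fixed,
-- and along that order the bound and the set of pruned edges are obtained
-- from the tentative distances by finitely many comparisons.

module Submission where

open import Defs
open import Axiom.ExcludedMiddle using (ExcludedMiddle)
open import Algebra.Solver.Ring.AlmostCommutativeRing using (fromCommutativeRing; _-Raw-AlmostCommutative⟶_)
import Algebra.Construct.NaturalChoice.Min as Min
import Algebra.Properties.CommutativeSemigroup as CommutativeSemigroupProperties
import Algebra.Properties.CommutativeSemiring.Exp as Exp
import Algebra.Properties.Ring as RingProperties
import Algebra.Properties.Semiring.Mult as Mult
import Algebra.Properties.Semiring.Mult.TCOptimised as Mult′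
import Algebra.Solver.Ring as RingSolver
open import Data.Bool.Base using (if_then_else_; true; false)
open import Data.Empty using (⊥-elim)
open import Data.Fin.Base using (Fin; toℕ)
open import Data.Fin.Subset using (⁅_⁆) renaming (_∪_ to _∪ₛ_)
open import Data.Fin.Subset.Properties using (_∈?_)
open import Data.Integer.Base as ℤ using (ℤ; +_; -[1+_]; _⊖_; +-*-rawRing)
import Data.Integer.Properties as ℤ
open import Data.List.Base using (List; []; _∷_; foldl; length; map)
open import Data.List.Membership.DecPropositional using () renaming (_∈?_ to member?)
open import Data.List.Membership.Propositional using () renaming (_∈_ to _∈ˡ_)
open import Data.List.Properties using (map-cong-local)
open import Data.List.Relation.Unary.All as All using (All; []; _∷_)
open import Data.List.Relation.Unary.AllPairs using ([]; _∷_)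
open import Data.List.Relation.Unary.Any using (here; there)
open import Data.List.Relation.Unary.Unique.Propositional using (Unique)
open import Data.Maybe.Base as Maybe using (just; nothing)
open import Data.Nat.Base as ℕ using (ℕ; zero; suc; _!)
import Data.Nat.ListAction as ℕList
import Data.Nat.Properties as ℕ
open import Data.Product.Base using (_×_; _,_; proj₁; proj₂; ∃-syntax)
import Data.Sign.Base as Sign
open import Data.Sum.Base using (_⊎_; inj₁; inj₂; [_,_]′)
open import Function.Base using (_∘_)
open import Function.Bundles using (Equivalence)
open import Level using (0ℓ)
open import Relation.Binary.Bundles using (DecTotalOrder)
import Relation.Binary.Properties.DecTotalOrder as DecTotalOrderProperties
open import Relation.Binary.PropositionalEquality as ≡ using (_≡_; _≢_)
import Relation.Binary.Reasoning.Setoid as SetoidReasoning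
open import Relation.Nullary using (¬_; yes; no; Dec; contradiction)
open import Relation.Nullary.Decidable using (does; dec⇒maybe; decidable-stable; _⊎-dec_)
open import Relation.Unary using (Pred; ∁; ⋃; _≐_; _⊥_; U; _∩_; _∪_; _⊆_; ∅)

-- Pruning through `B` depends on the edges scanned earlier, so the indicators summed in `X` need
-- not be independent; only the comparison with the fixed `P` yields independent events.
-- Measurability of `X` must be proved all the same: `IsExpectation` demands it, and nothing is
-- assumed about `ℙ` outside the σ-algebra. Base 2 keeps every exponent a natural number, and
-- halving for each exceedance turns the moment argument into an induction over the list. The
-- constants come from q = p/8. Then 1 - p/2 = 1 - 4q; one q is spent on n, as ln n ≤ Nq, and the
-- other 3q must outweigh 2^r with r ≤ 4qN. This amounts to ln 2 ≤ 3/4, which 2 ≤ (9/8)^6 certifies.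
-- As ln n is given only as a number whose exponential series sums to n, its sign is not known in
-- advance, while the comparison of that series with powers needs a nonnegative argument. Hence
-- negative arguments have to be excluded for n ≥ 2; for n = 1 the claimed probability is 0.

-- A ring solver with integer coefficients.

module RingSolving (ℝ : CompleteOrderedField) where
  open CompleteOrderedField ℝ hiding (zero)
  open RingProperties ring
  open CommutativeSemigroupProperties +-commutativeSemigroup using (interchange)
  open SetoidReasoning setoid
  module ×′ = Mult′ semiring
  open ×′ using () renaming (_×_ to _×′_)

  -- With `×′`, the term `1 ×′ 1#` reduces to `1#`, so that the solver constant `con (+ 1)` denotes
  -- `1#` itself.
  fromℤ : ℤ → Carrier
  fromℤ (+ k)    = k ×′ 1#
  fromℤ -[1+ k ] = - (suc k ×′ 1#)

  ×′1≈fromℕ : ∀ k → k ×′ 1# ≈ fromℕ k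
  ×′1≈fromℕ k = sym (×′.×ᵤ≈× k 1#)

  fromℤ-⊖ : ∀ j k → fromℤ (j ⊖ k) ≈ fromℕ j - fromℕ k
  fromℤ-⊖ j zero = begin
    fromℤ (j ⊖ 0)       ≡⟨ ≡.cong fromℤ (ℤ.⊖-≥ {j} {0} ℕ.z≤n) ⟩
    j ×′ 1#             ≈⟨ ×′1≈fromℕ j ⟩
    fromℕ j             ≈⟨ +-identityʳ _ ⟨
    fromℕ j + 0#        ≈⟨ +-congˡ -0#≈0# ⟨
    fromℕ j - fromℕ 0   ∎
  fromℤ-⊖ zero (suc k) = begin
    - (suc k ×′ 1#)          ≈⟨ -‿cong (×′1≈fromℕ (suc k)) ⟩
    - fromℕ (suc k)          ≈⟨ +-identityˡ _ ⟨
    fromℕ 0 - fromℕ (suc k)  ∎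
  fromℤ-⊖ (suc j) (suc k) = begin
    fromℤ (suc j ⊖ suc k)                   ≡⟨ ≡.cong fromℤ (ℤ.[1+m]⊖[1+n]≡m⊖n j k) ⟩
    fromℤ (j ⊖ k)                           ≈⟨ fromℤ-⊖ j k ⟩
    fromℕ j - fromℕ k                       ≈⟨ +-identityˡ _ ⟨
    0# + (fromℕ j - fromℕ k)                ≈⟨ +-congʳ (-‿inverseʳ 1#) ⟨
    (1# - 1#) + (fromℕ j - fromℕ k)         ≈⟨ interchange _ _ _ _ ⟩
    fromℕ (suc j) + (- 1# - fromℕ k)        ≈⟨ +-congˡ (-‿+-comm _ _) ⟩
    fromℕ (suc j) - fromℕ (suc k)           ∎

  fromℤ-+ : ∀ i j → fromℤ (i ℤ.+ j) ≈ fromℤ i + fromℤ j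
  fromℤ-+ (+ j) (+ k) = begin
    (j ℕ.+ k) ×′ 1#        ≈⟨ ×′.×-homo-+ 1# j k ⟩
    j ×′ 1# + k ×′ 1#      ∎
  fromℤ-+ (+ j) -[1+ k ] = begin
    fromℤ (j ⊖ suc k)            ≈⟨ fromℤ-⊖ j (suc k) ⟩
    fromℕ j - fromℕ (suc k)      ≈⟨ +-cong (×′1≈fromℕ j) (-‿cong (×′1≈fromℕ (suc k))) ⟨
    j ×′ 1# - suc k ×′ 1#        ∎
  fromℤ-+ -[1+ j ] (+ k) = begin
    fromℤ (k ⊖ suc j)            ≈⟨ fromℤ-⊖ k (suc j) ⟩
    fromℕ k - fromℕ (suc j)      ≈⟨ +-cong (×′1≈fromℕ k) (-‿cong (×′1≈fromℕ (suc j))) ⟨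
    k ×′ 1# - suc j ×′ 1#        ≈⟨ +-comm _ _ ⟩
    - (suc j ×′ 1#) + k ×′ 1#    ∎
  fromℤ-+ -[1+ j ] -[1+ k ] = begin
    - (suc (suc (j ℕ.+ k)) ×′ 1#)      ≡⟨ ≡.cong (λ i → - (i ×′ 1#)) (≡.sym (ℕ.+-suc (suc j) k)) ⟩
    - ((suc j ℕ.+ suc k) ×′ 1#)        ≈⟨ -‿cong (×′.×-homo-+ 1# (suc j) (suc k)) ⟩
    - (suc j ×′ 1# + suc k ×′ 1#)      ≈⟨ -‿+-comm _ _ ⟨
    - (suc j ×′ 1#) - suc k ×′ 1#      ∎

  fromℤ-neg : ∀ i → fromℤ (ℤ.- i) ≈ - fromℤ i
  fromℤ-neg (+ zero)  = sym -0#≈0#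
  fromℤ-neg (+ suc k) = refl
  fromℤ-neg -[1+ k ]  = sym (-‿involutive _)

  fromℤ-◃⁻ : ∀ k → fromℤ (Sign.- ℤ.◃ k) ≈ - (k ×′ 1#)
  fromℤ-◃⁻ k = trans (reflexive (≡.cong fromℤ (ℤ.-◃n≡-n k))) (fromℤ-neg (+ k))

  fromℤ-* : ∀ i j → fromℤ (i ℤ.* j) ≈ fromℤ i * fromℤ j
  fromℤ-* (+ j) (+ k) = begin
    fromℤ (Sign.+ ℤ.◃ (j ℕ.* k))   ≡⟨ ≡.cong fromℤ (ℤ.+◃n≡+n (j ℕ.* k)) ⟩
    (j ℕ.* k) ×′ 1#                ≈⟨ ×′.×1-homo-* j k ⟩
    j ×′ 1# * k ×′ 1#              ∎
  fromℤ-* (+ j) -[1+ k ] = begin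
    fromℤ (Sign.- ℤ.◃ (j ℕ.* suc k))  ≈⟨ fromℤ-◃⁻ (j ℕ.* suc k) ⟩
    - ((j ℕ.* suc k) ×′ 1#)           ≈⟨ -‿cong (×′.×1-homo-* j (suc k)) ⟩
    - (j ×′ 1# * suc k ×′ 1#)         ≈⟨ -‿distribʳ-* _ _ ⟩
    j ×′ 1# * - (suc k ×′ 1#)         ∎
  fromℤ-* -[1+ j ] (+ k) = begin
    fromℤ (Sign.- ℤ.◃ (suc j ℕ.* k))  ≈⟨ fromℤ-◃⁻ (suc j ℕ.* k) ⟩
    - ((suc j ℕ.* k) ×′ 1#)           ≈⟨ -‿cong (×′.×1-homo-* (suc j) k) ⟩
    - (suc j ×′ 1# * k ×′ 1#)         ≈⟨ -‿distribˡ-* _ _ ⟩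
    - (suc j ×′ 1#) * k ×′ 1#         ∎
  fromℤ-* -[1+ j ] -[1+ k ] = begin
    (suc j ℕ.* suc k) ×′ 1#             ≈⟨ ×′.×1-homo-* (suc j) (suc k) ⟩
    suc j ×′ 1# * suc k ×′ 1#           ≈⟨ -‿involutive _ ⟨
    - - (suc j ×′ 1# * suc k ×′ 1#)     ≈⟨ -‿cong (-‿distribˡ-* _ _) ⟩
    - (- (suc j ×′ 1#) * suc k ×′ 1#)   ≈⟨ -‿distribʳ-* _ _ ⟩
    - (suc j ×′ 1#) * - (suc k ×′ 1#)   ∎

  fromℤ-morphism : +-*-rawRing -Raw-AlmostCommutative⟶ fromCommutativeRing commutativeRing
  fromℤ-morphism = record
    { ⟦_⟧    = fromℤ
    ; +-homo = fromℤ-+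
    ; *-homo = fromℤ-*
    ; -‿homo = fromℤ-neg
    ; 0-homo = refl
    ; 1-homo = refl
    }

  open RingSolver +-*-rawRing (fromCommutativeRing commutativeRing) fromℤ-morphism
    (λ i j → Maybe.map (λ i≡j → reflexive (≡.cong fromℤ i≡j)) (dec⇒maybe (i ℤ.≟ j))) public
    using (Polynomial; solve; con; _:+_; _:*_; _:-_; :-_; _:=_)

  -- Evaluates to fromℕ k definitionally, unlike con (+ k).
  num : ∀ {j} → ℕ → Polynomial j
  num zero    = con (+ 0)
  num (suc k) = con (+ 1) :+ num k

-- Ordered field arithmetic and the Archimedean property.

module OrderedField (em : ExcludedMiddle 0ℓ) (ℝ : CompleteOrderedField) where
  open CompleteOrderedField ℝ hiding (zero)
  open RingSolving ℝ using (solve; con; _:+_; _:*_; _:-_; :-_; _:=_)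
  open DecTotalOrder decTotalOrder public using () renaming
    (refl to ≤-refl; trans to ≤-trans; reflexive to ≤-reflexive; antisym to ≤-antisym; total to ≤-total;
     ≤-respˡ-≈ to ≤-respˡ-≈; ≤-respʳ-≈ to ≤-respʳ-≈)
  open DecTotalOrderProperties decTotalOrder public using (≰⇒>; ≮⇒≥; <⇒≱)
  open Exp commutativeSemiring public using (^-congˡ; ^-assocʳ; ^-distrib-*)

  <⇒≤ : ∀ {x y} → x < y → x ≤ y
  <⇒≤ = proj₁

  <-≤-trans : ∀ {x y z} → x < y → y ≤ z → x < z
  <-≤-trans x<y y≤z = ≰⇒> λ z≤x → <⇒≱ x<y (≤-trans y≤z z≤x)

  ≤-<-trans : ∀ {x y z} → x ≤ y → y < z → x < z
  ≤-<-trans x≤y y<z = ≰⇒> λ z≤x → <⇒≱ y<z (≤-trans z≤x x≤y)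

  x≤y⇒0≤y-x : ∀ {x y} → x ≤ y → 0# ≤ y - x
  x≤y⇒0≤y-x {x} x≤y = ≤-respˡ-≈ (-‿inverseʳ x) (+-monoˡ-≤ (- x) x≤y)

  -- Inequalities are proved by exhibiting the difference of the two sides
  -- as an expression that is visibly nonnegative.
  difference : ∀ {x y e} → 0# ≤ e → e ≈ y - x → x ≤ y
  difference {x} {y} 0≤e e≈y-x = ≤-respˡ-≈ (+-identityˡ x)
    (≤-respʳ-≈ (trans (+-congʳ e≈y-x) (solve 2 (λ x y → (y :- x) :+ x := y) refl x y)) (+-monoˡ-≤ x 0≤e))

  +-nonneg : ∀ {x y} → 0# ≤ x → 0# ≤ y → 0# ≤ x + y
  +-nonneg {x} {y} 0≤x 0≤y = ≤-trans 0≤y (≤-respˡ-≈ (+-identityˡ y) (+-monoˡ-≤ y 0≤x))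

  +-mono-≤ : ∀ {x y u v} → x ≤ y → u ≤ v → x + u ≤ y + v
  +-mono-≤ {x} {y} {u} {v} x≤y u≤v = difference (+-nonneg (x≤y⇒0≤y-x x≤y) (x≤y⇒0≤y-x u≤v))
    (solve 4 (λ x y u v → (y :- x) :+ (v :- u) := (y :+ v) :- (x :+ u)) refl x y u v)

  -‿anti-≤ : ∀ {x y} → x ≤ y → - y ≤ - x
  -‿anti-≤ {x} {y} x≤y = difference (x≤y⇒0≤y-x x≤y) (solve 2 (λ x y → y :- x := (:- x) :- (:- y)) refl x y)

  0≤1 : 0# ≤ 1#
  0≤1 with ≤-total 0# 1#
  ... | inj₁ 0≤1 = 0≤1
  ... | inj₂ 1≤0 = difference (*-nonneg (x≤y⇒0≤y-x 1≤0) (x≤y⇒0≤y-x 1≤0))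
    (solve 0 ((con (+ 0) :- con (+ 1)) :* (con (+ 0) :- con (+ 1)) := con (+ 1) :- con (+ 0)) refl)

  0<1 : 0# < 1#
  0<1 = 0≤1 , 0≉1

  *-mono-≤ : ∀ {x y u v} → 0# ≤ x → x ≤ y → 0# ≤ u → u ≤ v → x * u ≤ y * v
  *-mono-≤ {x} {y} {u} {v} 0≤x x≤y 0≤u u≤v =
    difference (+-nonneg (*-nonneg (x≤y⇒0≤y-x x≤y) (≤-trans 0≤u u≤v)) (*-nonneg 0≤x (x≤y⇒0≤y-x u≤v)))
      (solve 4 (λ x y u v → (y :- x) :* v :+ x :* (v :- u) := y :* v :- x :* u) refl x y u v)

  *-monoˡ-≤ : ∀ {x y} z → 0# ≤ z → x ≤ y → z * x ≤ z * y
  *-monoˡ-≤ {x} {y} z 0≤z x≤y = difference (*-nonneg 0≤z (x≤y⇒0≤y-x x≤y))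
    (solve 3 (λ x y z → z :* (y :- x) := z :* y :- z :* x) refl x y z)

  ⁻¹-inverse : ∀ {x} → 0# < x → x * x ⁻¹ ≈ 1#
  ⁻¹-inverse {x} (0≤x , 0≉x) = ⁻¹-inverseʳ x λ x≈0 → 0≉x (sym x≈0)

  *-pos : ∀ {x y} → 0# < x → 0# < y → 0# < x * y
  *-pos {x} {y} 0<x (0≤y , 0≉y) = *-nonneg (<⇒≤ 0<x) 0≤y , λ 0≈xy → 0≉y (begin
    0#                  ≈⟨ zeroʳ _ ⟨
    x ⁻¹ * 0#           ≈⟨ *-congˡ 0≈xy ⟩
    x ⁻¹ * (x * y)      ≈⟨ solve 3 (λ x y z → z :* (x :* y) := (x :* z) :* y) refl x y (x ⁻¹) ⟩
    (x * x ⁻¹) * y      ≈⟨ *-congʳ (⁻¹-inverse 0<x) ⟩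
    1# * y              ≈⟨ *-identityˡ y ⟩
    y                   ∎)
    where open SetoidReasoning setoid

  x<y⇒0<y-x : ∀ {x y} → x < y → 0# < y - x
  x<y⇒0<y-x {x} {y} x<y = ≰⇒> λ y-x≤0 → <⇒≱ x<y (difference (x≤y⇒0≤y-x y-x≤0)
    (solve 2 (λ x y → con (+ 0) :- (y :- x) := x :- y) refl x y))

  strict-difference : ∀ {x y e} → 0# < e → e ≈ y - x → x < y
  strict-difference {x} {y} {e} 0<e e≈ = ≰⇒> λ y≤x → <⇒≱ 0<e (difference (x≤y⇒0≤y-x y≤x)
    (trans (solve 2 (λ x y → x :- y := con (+ 0) :- (y :- x)) refl x y) (+-congˡ (-‿cong (sym e≈)))))

  *-cancel-≤ : ∀ {x y c} → 0# < c → c * x ≤ c * y → x ≤ y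
  *-cancel-≤ {x} {y} {c} 0<c cx≤cy = ≮⇒≥ λ y<x → <⇒≱
    (strict-difference (*-pos 0<c (x<y⇒0<y-x y<x)) (solve 3 (λ x y c → c :* (x :- y) := c :* x :- c :* y) refl x y c))
    cx≤cy

  ⁻¹-pos : ∀ {x} → 0# < x → 0# < x ⁻¹
  ⁻¹-pos {x} 0<x = ≰⇒> λ x⁻¹≤0 → <⇒≱ 0<1
    (≤-respˡ-≈ (⁻¹-inverse 0<x) (≤-respʳ-≈ (zeroʳ x) (*-monoˡ-≤ x (<⇒≤ 0<x) x⁻¹≤0)))

  +-pos : ∀ {x y} → 0# < x → 0# ≤ y → 0# < x + y
  +-pos {x} {y} 0<x 0≤y = <-≤-trans 0<x (difference 0≤y (solve 2 (λ x y → y := (x :+ y) :- x) refl x y))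

  fromℕ-nonneg : ∀ k → 0# ≤ fromℕ k
  fromℕ-nonneg zero    = ≤-refl
  fromℕ-nonneg (suc k) = +-nonneg 0≤1 (fromℕ-nonneg k)

  fromℕ-pos : ∀ k → 0# < fromℕ (suc k)
  fromℕ-pos k = +-pos 0<1 (fromℕ-nonneg k)

  fromℕ-+ : ∀ j k → fromℕ (j ℕ.+ k) ≈ fromℕ j + fromℕ k
  fromℕ-+ = Mult.×-homo-+ semiring 1#

  fromℕ-* : ∀ j k → fromℕ (j ℕ.* k) ≈ fromℕ j * fromℕ k
  fromℕ-* = Mult.×1-homo-* semiring

  fromℕ-mono : ∀ {j k} → j ℕ.≤ k → fromℕ j ≤ fromℕ k
  fromℕ-mono {k = k} ℕ.z≤n = fromℕ-nonneg k
  fromℕ-mono (ℕ.s≤s j≤k) = +-mono-≤ ≤-refl (fromℕ-mono j≤k)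

  pos! : ∀ k → 0# < fromℕ (k !)
  pos! k with k ! | ℕ._!≢0 k
  ... | suc j | _ = fromℕ-pos j

  ^-nonneg : ∀ {x} k → 0# ≤ x → 0# ≤ x ^ k
  ^-nonneg zero    0≤x = 0≤1
  ^-nonneg (suc k) 0≤x = *-nonneg 0≤x (^-nonneg k 0≤x)

  ^-pos : ∀ {x} k → 0# < x → 0# < x ^ k
  ^-pos zero    0<x = 0<1
  ^-pos (suc k) 0<x = *-pos 0<x (^-pos k 0<x)

  ^-mono-≤ : ∀ {x y} k → 0# ≤ x → x ≤ y → x ^ k ≤ y ^ k
  ^-mono-≤ zero    0≤x x≤y = ≤-refl
  ^-mono-≤ (suc k) 0≤x x≤y = *-mono-≤ 0≤x x≤y (^-nonneg k 0≤x) (^-mono-≤ k 0≤x x≤y)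

  1^k≈1 : ∀ k → 1# ^ k ≈ 1#
  1^k≈1 zero    = refl
  1^k≈1 (suc k) = trans (*-identityˡ _) (1^k≈1 k)

  ^-≤1 : ∀ {x} k → 0# ≤ x → x ≤ 1# → x ^ k ≤ 1#
  ^-≤1 k 0≤x x≤1 = ≤-respʳ-≈ (1^k≈1 k) (^-mono-≤ k 0≤x x≤1)

  bernoulli : ∀ {z} k → 0# ≤ z → 1# + fromℕ k * z ≤ (1# + z) ^ k
  bernoulli {z} zero    0≤z = ≤-reflexive (solve 1 (λ z → con (+ 1) :+ con (+ 0) :* z := con (+ 1)) refl z)
  bernoulli {z} (suc k) 0≤z = ≤-trans
    (difference (*-nonneg (fromℕ-nonneg k) (*-nonneg 0≤z 0≤z))
      (solve 2 (λ z κ → κ :* (z :* z) :=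
        (con (+ 1) :+ z) :* (con (+ 1) :+ κ :* z) :- (con (+ 1) :+ (con (+ 1) :+ κ) :* z)) refl z (fromℕ k)))
    (*-monoˡ-≤ (1# + z) (+-nonneg 0≤1 0≤z) (bernoulli k 0≤z))

  limit-≤ : ∀ {a l b} → Analysis._⟶_ ℝ a l → (∀ k → a k ≤ b) → l ≤ b
  limit-≤ {a} {l} {b} a⟶l a≤b = ≮⇒≥ λ b<l →
    let N , close = a⟶l (l - b) (x<y⇒0<y-x b<l) in
    <⇒≱ (proj₁ (close N ℕ.≤-refl))
      (≤-respʳ-≈ (solve 2 (λ l b → b := l :- (l :- b)) refl l b) (a≤b N))

  -- If no `fromℕ k` exceeded `x`, the set of numbers below some `fromℕ k` would have a supremum
  -- `b`. That set is closed under adding `1#`, so `b - 1#` would be an upper bound as well.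
  archimedean : ∀ x → ∃[ k ] x < fromℕ k
  archimedean x = decidable-stable em λ unbounded →
    let b , ub , least = supremum (λ y → ∃[ k ] y ≤ fromℕ k) (0# , 0 , ≤-refl)
          (x , λ { y (k , y≤k) → ≤-trans y≤k (≮⇒≥ λ x<k → unbounded (k , x<k)) })
    in <⇒≱ 0<1 (difference
        (x≤y⇒0≤y-x (least (b - 1#) λ { y (k , y≤k) →
          difference (x≤y⇒0≤y-x (ub (1# + y) (suc k , +-mono-≤ ≤-refl y≤k)))
            (solve 2 (λ b y → b :- (con (+ 1) :+ y) := (b :- con (+ 1)) :- y) refl b y) }))
        (solve 1 (λ b → (b :- con (+ 1)) :- b := con (+ 0) :- con (+ 1)) refl b))

  archimedean-* : ∀ {x} → 0# < x → ∀ y → ∃[ k ] y < fromℕ k * x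
  archimedean-* {x} 0<x y with archimedean (y * x ⁻¹)
  ... | k , y/x<k = k , strict-difference (*-pos (x<y⇒0<y-x y/x<k) 0<x) (trans
    (solve 4 (λ x y κ i → (κ :- y :* i) :* x := κ :* x :- y :* (x :* i)) refl x y (fromℕ k) (x ⁻¹))
    (+-congˡ (-‿cong (trans (*-congˡ (⁻¹-inverse 0<x)) (*-identityʳ y)))))

-- Partial sums of sequences.

module PartialSums (em : ExcludedMiddle 0ℓ) (ℝ : CompleteOrderedField) where
  open CompleteOrderedField ℝ hiding (zero)
  open RingSolving ℝ using (solve; _:+_; _:=_)
  open OrderedField em ℝ

  -- Extended at the end, whereas `sum` splits off its first entry; inductions on the truncation
  -- order need the last term.
  partialSum : (ℕ → Carrier) → ℕ → Carrier
  partialSum a zero    = 0#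
  partialSum a (suc k) = partialSum a k + a k

  partialSum-head : ∀ a k → partialSum a (suc k) ≈ a 0 + partialSum (a ∘ suc) k
  partialSum-head a zero    = +-comm _ _
  partialSum-head a (suc k) = trans (+-congʳ (partialSum-head a k)) (+-assoc _ _ _)

  sum≈partialSum : ∀ a k → sum {k} (a ∘ toℕ) ≈ partialSum a k
  sum≈partialSum a zero    = refl
  sum≈partialSum a (suc k) = trans (+-congˡ (sum≈partialSum (a ∘ suc) k)) (sym (partialSum-head a k))

  partialSum-mono : ∀ {a b} → (∀ k → a k ≤ b k) → ∀ k → partialSum a k ≤ partialSum b k
  partialSum-mono a≤b zero    = ≤-refl
  partialSum-mono a≤b (suc k) = +-mono-≤ (partialSum-mono a≤b k) (a≤b k)

  partialSum-nonneg : ∀ {a} → (∀ k → 0# ≤ a k) → ∀ k → 0# ≤ partialSum a k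
  partialSum-nonneg 0≤a zero    = ≤-refl
  partialSum-nonneg 0≤a (suc k) = +-nonneg (partialSum-nonneg 0≤a k) (0≤a k)

  partialSum-cong : ∀ {a b} → (∀ k → a k ≈ b k) → ∀ k → partialSum a k ≈ partialSum b k
  partialSum-cong a≈b zero    = refl
  partialSum-cong a≈b (suc k) = +-cong (partialSum-cong a≈b k) (a≈b k)

  partialSum-+ : ∀ a b k → partialSum (λ j → a j + b j) k ≈ partialSum a k + partialSum b k
  partialSum-+ a b zero    = sym (+-identityʳ 0#)
  partialSum-+ a b (suc k) = trans (+-congʳ (partialSum-+ a b k))
    (solve 4 (λ x y u v → (x :+ y) :+ (u :+ v) := (x :+ u) :+ (y :+ v)) refl (partialSum a k) (partialSum b k) (a k) (b k))

-- The exponential series against powers, for nonnegative arguments.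

module Exponential (em : ExcludedMiddle 0ℓ) (ℝ : CompleteOrderedField) where
  open CompleteOrderedField ℝ hiding (zero)
  open Analysis ℝ
  open RingSolving ℝ using (solve; con; num; _:+_; _:*_; _:-_; :-_; _:=_)
  open OrderedField em ℝ
  open PartialSums em ℝ

  1/_! : ℕ → Carrier
  1/ k ! = fromℕ (k !) ⁻¹

  1/!-nonneg : ∀ k → 0# ≤ 1/ k !
  1/!-nonneg k = <⇒≤ (⁻¹-pos (pos! k))

  1/!-suc : ∀ k → fromℕ (suc k) * 1/ suc k ! ≈ 1/ k !
  1/!-suc k = begin
    κ * 1/ suc k !                     ≈⟨ *-identityʳ _ ⟨
    κ * 1/ suc k ! * 1#                ≈⟨ *-congˡ (⁻¹-inverse (pos! k)) ⟨
    κ * 1/ suc k ! * (F * 1/ k !)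
      ≈⟨ solve 4 (λ κ i f j → κ :* i :* (f :* j) := ((κ :* f) :* i) :* j) refl κ (1/ suc k !) F (1/ k !) ⟩
    ((κ * F) * 1/ suc k !) * 1/ k !    ≈⟨ *-congʳ (*-congʳ (fromℕ-* (suc k) (k !))) ⟨
    (fromℕ (suc k !) * 1/ suc k !) * 1/ k !  ≈⟨ *-congʳ (⁻¹-inverse (pos! (suc k))) ⟩
    1# * 1/ k !                        ≈⟨ *-identityˡ _ ⟩
    1/ k !                             ∎
    where
    open SetoidReasoning setoid
    κ = fromℕ (suc k)
    F = fromℕ (k !)

  term : Carrier → ℕ → Carrier
  term x k = x ^ k * 1/ k !

  expSum : Carrier → ℕ → Carrier
  expSum x = partialSum (term x)

  expSum-zero : ∀ {x} → x ≈ 0# → ∀ k → expSum x (suc k) ≈ 1#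
  expSum-zero x≈0 zero    = trans (+-identityˡ _)
    (trans (*-congʳ (sym (+-identityʳ 1#))) (⁻¹-inverse (fromℕ-pos 0)))
  expSum-zero {x} x≈0 (suc k) = begin
    expSum x (suc k) + (x * x ^ k) * 1/ suc k !    ≈⟨ +-cong (expSum-zero x≈0 k) (*-congʳ (*-congʳ x≈0)) ⟩
    1# + (0# * x ^ k) * 1/ suc k !
      ≈⟨ solve 2 (λ u v → con (+ 1) :+ (con (+ 0) :* u) :* v := con (+ 1)) refl (x ^ k) (1/ suc k !) ⟩
    1#                                             ∎
    where open SetoidReasoning setoid

  expSum-zero-≤1 : ∀ {x} → x ≈ 0# → ∀ k → expSum x k ≤ 1#
  expSum-zero-≤1 x≈0 zero    = 0≤1
  expSum-zero-≤1 x≈0 (suc k) = ≤-reflexive (expSum-zero x≈0 k)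

  term-mono : ∀ {x y} → 0# ≤ x → x ≤ y → ∀ k → term x k ≤ term y k
  term-mono 0≤x x≤y k = *-mono-≤ (^-nonneg k 0≤x) (^-mono-≤ k 0≤x x≤y) (1/!-nonneg k) ≤-refl

  -- The mean value estimate for a power, with the derivative taken at the larger point `a`.
  ^-increment-≤ : ∀ {a b q} → 0# ≤ b → 0# ≤ q → a ≈ b + q →
                  ∀ k → a ^ suc k - b ^ suc k ≤ fromℕ (suc k) * (q * a ^ k)
  ^-increment-≤ {a} {b} {q} 0≤b 0≤q a≈b+q zero = ≤-reflexive (trans (+-congʳ (*-congʳ a≈b+q))
    (solve 2 (λ b q → (b :+ q) :* con (+ 1) :- b :* con (+ 1) := num 1 :* (q :* con (+ 1))) refl b q))
  ^-increment-≤ {a} {b} {q} 0≤b 0≤q a≈b+q (suc k) =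
    difference (+-nonneg (*-nonneg 0≤a (x≤y⇒0≤y-x (^-increment-≤ 0≤b 0≤q a≈b+q k)))
                         (*-nonneg 0≤q (x≤y⇒0≤y-x (^-mono-≤ (suc k) 0≤b b≤a))))
      (begin
        a * (κ * (q * A) - (a * A - b * B)) + q * (a * A - b * B)
          ≈⟨ solve 6 (λ a b q A B κ →
              a :* (κ :* (q :* A) :- (a :* A :- b :* B)) :+ q :* (a :* A :- b :* B) :=
              (con (+ 1) :+ κ) :* (q :* (a :* A)) :- (a :* (a :* A) :- (a :- q) :* (b :* B))) refl a b q A B κ ⟩
        (1# + κ) * (q * (a * A)) - (a * (a * A) - (a - q) * (b * B))
          ≈⟨ +-congˡ (-‿cong (+-congˡ (-‿cong (*-congʳ a-q≈b)))) ⟩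
        (1# + κ) * (q * (a * A)) - (a * (a * A) - b * (b * B)) ∎)
    where
    open SetoidReasoning setoid
    A = a ^ k
    B = b ^ k
    κ = fromℕ (suc k)
    b≤a : b ≤ a
    b≤a = ≤-respʳ-≈ (sym a≈b+q) (difference 0≤q (solve 2 (λ b q → q := (b :+ q) :- b) refl b q))
    0≤a = ≤-trans 0≤b b≤a
    a-q≈b : a - q ≈ b
    a-q≈b = trans (+-congʳ a≈b+q) (solve 2 (λ b q → (b :+ q) :- q := b) refl b q)

  -- The discrete form of exp' = exp, summing `^-increment-≤` with factorial weights. By `1/!-suc`,
  -- differentiation lowers the degree of each term by one, so the sum on the right is one term
  -- shorter.
  expSum-increment-≤ : ∀ {a b q} → 0# ≤ b → 0# ≤ q → a ≈ b + q →
                       ∀ k → expSum a (suc k) - expSum b (suc k) ≤ q * expSum a k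
  expSum-increment-≤ {a} {b} {q} 0≤b 0≤q a≈b+q zero =
    ≤-reflexive (solve 2 (λ t q → (con (+ 0) :+ t) :- (con (+ 0) :+ t) := q :* con (+ 0)) refl (term a 0) q)
  expSum-increment-≤ {a} {b} {q} 0≤b 0≤q a≈b+q (suc k) =
    difference (+-nonneg (x≤y⇒0≤y-x (expSum-increment-≤ 0≤b 0≤q a≈b+q k))
                         (*-nonneg (1/!-nonneg (suc k)) (x≤y⇒0≤y-x (^-increment-≤ 0≤b 0≤q a≈b+q k))))
      (begin
        (q * S - (S′ - T′)) + I * (κ * (q * A) - (A′ - B′))
          ≈⟨ solve 9 (λ q S S′ T′ I κ A A′ B′ →
              (q :* S :- (S′ :- T′)) :+ I :* (κ :* (q :* A) :- (A′ :- B′)) :=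
              q :* (S :+ A :* (κ :* I)) :- ((S′ :+ A′ :* I) :- (T′ :+ B′ :* I))) refl q S S′ T′ I κ A A′ B′ ⟩
        q * (S + A * (κ * I)) - ((S′ + A′ * I) - (T′ + B′ * I))
          ≈⟨ +-congʳ (*-congˡ (+-congˡ (*-congˡ (1/!-suc k)))) ⟩
        q * (S + A * 1/ k !) - ((S′ + A′ * I) - (T′ + B′ * I)) ∎)
    where
    open SetoidReasoning setoid
    S = expSum a k
    S′ = expSum a (suc k)
    T′ = expSum b (suc k)
    I = 1/ suc k !
    κ = fromℕ (suc k)
    A = a ^ k
    A′ = a ^ suc k
    B′ = b ^ suc k

  -- The increment is at most `q` times the truncation at `a`, because the term missing on the right
  -- of `expSum-increment-≤` is nonnegative.
  expSum-step : ∀ {a b q} → 0# ≤ b → 0# ≤ q → a ≈ b + q →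
                ∀ k → (1# - q) * expSum a k ≤ expSum b k
  expSum-step {a} {b} {q} 0≤b 0≤q a≈b+q zero    = ≤-reflexive (zeroʳ _)
  expSum-step {a} {b} {q} 0≤b 0≤q a≈b+q (suc k) =
    difference (+-nonneg (x≤y⇒0≤y-x (expSum-increment-≤ 0≤b 0≤q a≈b+q k))
                         (*-nonneg 0≤q (*-nonneg (^-nonneg k 0≤a) (1/!-nonneg k))))
      (solve 4 (λ q S t T′ → (q :* S :- ((S :+ t) :- T′)) :+ q :* t := T′ :- (con (+ 1) :- q) :* (S :+ t)) refl
        q (expSum a k) (term a k) (expSum b (suc k)))
    where
    0≤a : 0# ≤ a
    0≤a = ≤-respʳ-≈ (sym a≈b+q) (+-nonneg 0≤b 0≤q)

  -- Walks from `fromℕ N * q` down to zero in `N` steps of length `q`, each paid for by one factor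
  -- `1# - q`. The bound is uniform in the truncation order `k`.
  expSum-≤ : ∀ {q} → 0# ≤ q → q ≤ 1# → ∀ N k → (1# - q) ^ N * expSum (fromℕ N * q) k ≤ 1#
  expSum-≤ {q} 0≤q q≤1 zero    k = ≤-respˡ-≈ (sym (*-identityˡ _)) (expSum-zero-≤1 (zeroˡ q) k)
  expSum-≤ {q} 0≤q q≤1 (suc N) k = ≤-trans
    (≤-respˡ-≈ (solve 3 (λ u v s → v :* (u :* s) := (u :* v) :* s) refl (1# - q) ((1# - q) ^ N) (expSum (fromℕ (suc N) * q) k))
      (*-monoˡ-≤ ((1# - q) ^ N) (^-nonneg N (x≤y⇒0≤y-x q≤1))
        (expSum-step (*-nonneg (fromℕ-nonneg N) 0≤q) 0≤q
          (solve 2 (λ κ q → (con (+ 1) :+ κ) :* q := κ :* q :+ q) refl (fromℕ N) q) k)))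
    (expSum-≤ 0≤q q≤1 N k)

  -- All partial sums are at most the inverse of `W`, hence so is their limit `y`; `q < 1#` makes
  -- `W` invertible.
  exp-≤ : ∀ {x y q} N → IsExp x y → 0# ≤ x → 0# ≤ q → q < 1# → x ≤ fromℕ N * q → (1# - q) ^ N * y ≤ 1#
  exp-≤ {x} {y} {q} N isExp 0≤x 0≤q q<1 x≤Nq = ≤-respʳ-≈ (⁻¹-inverse 0<W)
    (*-monoˡ-≤ W (<⇒≤ 0<W) (limit-≤ isExp λ k → ≤-respˡ-≈ (sym (sum≈partialSum (term x) k))
      (*-cancel-≤ 0<W (≤-respʳ-≈ (sym (⁻¹-inverse 0<W)) (≤-trans
        (*-monoˡ-≤ W (<⇒≤ 0<W) (partialSum-mono (term-mono 0≤x x≤Nq) k))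
        (expSum-≤ 0≤q (<⇒≤ q<1) N k))))))
    where
    W = (1# - q) ^ N
    0<W : 0# < W
    0<W = ^-pos N (x<y⇒0<y-x q<1)

-- The exponential series at negative arguments.

module NegativeExponent (em : ExcludedMiddle 0ℓ) (ℝ : CompleteOrderedField) where
  open CompleteOrderedField ℝ hiding (zero)
  open Analysis ℝ
  open RingSolving ℝ using (solve; con; num; _:+_; _:*_; _:-_; :-_; _:=_)
  open OrderedField em ℝ
  open PartialSums em ℝ
  open Exponential em ℝ

  infix 4 ∣_∣≤_
  record ∣_∣≤_ (x c : Carrier) : Set where
    constructor between
    field
      lower : - c ≤ x
      upper : x ≤ c
  open ∣_∣≤_

  double-cancel : ∀ {x y} → x + x ≤ y + y → x ≤ y
  double-cancel {x} {y} 2x≤2y = *-cancel-≤ (fromℕ-pos 1) (≤-respˡ-≈ (2* x) (≤-respʳ-≈ (2* y) 2x≤2y))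
    where
    2* : ∀ z → z + z ≈ fromℕ 2 * z
    2* = solve 1 (λ z → z :+ z := num 2 :* z) refl

  ∣∣-cong : ∀ {x y c d} → x ≈ y → c ≈ d → ∣ x ∣≤ c → ∣ y ∣≤ d
  ∣∣-cong x≈y c≈d (between l u) =
    between (≤-respˡ-≈ (-‿cong c≈d) (≤-respʳ-≈ x≈y l)) (≤-respˡ-≈ x≈y (≤-respʳ-≈ c≈d u))

  ∣∣-+ : ∀ {x y c d} → ∣ x ∣≤ c → ∣ y ∣≤ d → ∣ x + y ∣≤ c + d
  ∣∣-+ {c = c} {d} (between l u) (between l′ u′) =
    between (≤-respˡ-≈ (solve 2 (λ c d → :- c :+ :- d := :- (c :+ d)) refl c d) (+-mono-≤ l l′)) (+-mono-≤ u u′)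

  -- Each slack is the sum of two products of nonnegative differences. The mixed terms cancel and
  -- leave twice the wanted slack, whence `double-cancel`.
  ∣∣-* : ∀ {x y c d} → ∣ x ∣≤ c → ∣ y ∣≤ d → ∣ x * y ∣≤ c * d
  ∣∣-* {x} {y} {c} {d} (between l u) (between l′ u′) = between
    (double-cancel (difference
      (+-nonneg (*-nonneg (x≤y⇒0≤y-x l) (x≤y⇒0≤y-x l′)) (*-nonneg (x≤y⇒0≤y-x u) (x≤y⇒0≤y-x u′)))
      (solve 4 (λ x y c d → (x :- (:- c)) :* (y :- (:- d)) :+ (c :- x) :* (d :- y) :=
        (x :* y :+ x :* y) :- (:- (c :* d) :+ :- (c :* d))) refl x y c d)))
    (double-cancel (difference
      (+-nonneg (*-nonneg (x≤y⇒0≤y-x l) (x≤y⇒0≤y-x u′)) (*-nonneg (x≤y⇒0≤y-x u) (x≤y⇒0≤y-x l′)))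
      (solve 4 (λ x y c d → (x :- (:- c)) :* (d :- y) :+ (c :- x) :* (y :- (:- d)) :=
        (c :* d :+ c :* d) :- (x :* y :+ x :* y)) refl x y c d)))

  nonneg⇒∣∣ : ∀ {x} → 0# ≤ x → ∣ x ∣≤ x
  nonneg⇒∣∣ {x} 0≤x = between
    (difference (+-nonneg 0≤x 0≤x) (solve 1 (λ x → x :+ x := x :- (:- x)) refl x)) ≤-refl

  ∣∣-^ : ∀ {x c} k → ∣ x ∣≤ c → ∣ x ^ k ∣≤ c ^ k
  ∣∣-^ zero    ∣x∣≤c = nonneg⇒∣∣ 0≤1
  ∣∣-^ (suc k) ∣x∣≤c = ∣∣-* ∣x∣≤c (∣∣-^ k ∣x∣≤c)

  module Step (Y : Carrier) where

    -- Y bounds the absolute values of both points; the recursion is that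
    -- of the second-order remainder of x^(k+1) when x moves by q, over q².
    remainder : ℕ → Carrier
    remainder zero    = 0#
    remainder (suc k) = Y * remainder k + fromℕ (suc k) * Y ^ k

    -- The coefficient of the squared step length in the error of the truncated series. It depends
    -- on `Y` and the order only, so the total error of `Y / q` steps of length `q` vanishes with
    -- `q`.
    taylorRemainder : ℕ → Carrier
    taylorRemainder = partialSum λ k → 1/ suc k ! * remainder k

    remainder-nonneg : 0# ≤ Y → ∀ k → 0# ≤ remainder k
    remainder-nonneg 0≤Y zero    = ≤-refl
    remainder-nonneg 0≤Y (suc k) =
      +-nonneg (*-nonneg 0≤Y (remainder-nonneg 0≤Y k)) (*-nonneg (fromℕ-nonneg (suc k)) (^-nonneg k 0≤Y))

    module _ {a b q : Carrier} (a≈b+q : a ≈ b + q) (∣a∣≤Y : ∣ a ∣≤ Y) (∣b∣≤Y : ∣ b ∣≤ Y) where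

      -- Only the upper half is used for `expSum-taylor`, but the induction multiplies the error by
      -- `b`, which may be negative, and so needs both halves.
      ^-taylor : ∀ k → ∣ b ^ suc k - a ^ suc k + fromℕ (suc k) * (q * a ^ k) ∣≤ remainder k * (q * q)
      ^-taylor zero = ∣∣-cong (trans (solve 2 (λ b q → con (+ 0) :=
            b :* con (+ 1) :- (b :+ q) :* con (+ 1) :+ num 1 :* (q :* con (+ 1))) refl b q)
          (+-congʳ (+-congˡ (-‿cong (*-congʳ (sym a≈b+q))))))
        (sym (zeroˡ (q * q))) (nonneg⇒∣∣ ≤-refl)
      ^-taylor (suc k) = ∣∣-cong
        (begin
          b * (b * B - a * A + κ * (q * A)) + κ * A * (q * q)
            ≈⟨ +-congʳ (*-congʳ b≈a-q) ⟩
          (a - q) * (b * B - a * A + κ * (q * A)) + κ * A * (q * q)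
            ≈⟨ solve 6 (λ a b q A B κ →
                (a :- q) :* (b :* B :- a :* A :+ κ :* (q :* A)) :+ κ :* A :* (q :* q) :=
                (a :- q) :* (b :* B) :- a :* (a :* A) :+ (con (+ 1) :+ κ) :* (q :* (a :* A))) refl a b q A B κ ⟩
          (a - q) * (b * B) - a * (a * A) + (1# + κ) * (q * (a * A))
            ≈⟨ +-congʳ (+-congʳ (*-congʳ b≈a-q)) ⟨
          b * (b * B) - a * (a * A) + (1# + κ) * (q * (a * A)) ∎)
        (solve 5 (λ y r κ z q → y :* (r :* (q :* q)) :+ κ :* z :* (q :* q) := (y :* r :+ κ :* z) :* (q :* q)) refl
          Y (remainder k) κ (Y ^ k) q)
        (∣∣-+ (∣∣-* ∣b∣≤Y (^-taylor k))
              (∣∣-* (∣∣-* (nonneg⇒∣∣ (fromℕ-nonneg (suc k))) (∣∣-^ k ∣a∣≤Y)) ∣q²∣≤q²))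
        where
        open SetoidReasoning setoid
        A = a ^ k
        B = b ^ k
        κ = fromℕ (suc k)
        b≈a-q : b ≈ a - q
        b≈a-q = trans (solve 2 (λ b q → b := (b :+ q) :- q) refl b q) (+-congʳ (sym a≈b+q))
        ∣q²∣≤q² : ∣ q * q ∣≤ q * q
        ∣q²∣≤q² with ≤-total 0# q
        ... | inj₁ 0≤q = nonneg⇒∣∣ (*-nonneg 0≤q 0≤q)
        ... | inj₂ q≤0 = nonneg⇒∣∣ (≤-respʳ-≈ (solve 1 (λ q → (con (+ 0) :- q) :* (con (+ 0) :- q) := q :* q) refl q)
          (*-nonneg (x≤y⇒0≤y-x q≤0) (x≤y⇒0≤y-x q≤0)))

      expSum-taylor : ∀ k → expSum b (suc k) - expSum a (suc k) + q * expSum a k ≤ taylorRemainder k * (q * q)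
      expSum-taylor zero = ≤-reflexive (solve 2 (λ t q →
        (con (+ 0) :+ t) :- (con (+ 0) :+ t) :+ q :* con (+ 0) := con (+ 0) :* (q :* q)) refl (term a 0) q)
      expSum-taylor (suc k) = difference
        (+-nonneg (x≤y⇒0≤y-x (expSum-taylor k))
                  (*-nonneg (1/!-nonneg (suc k)) (x≤y⇒0≤y-x (upper (^-taylor k)))))
        (begin
          (R * (q * q) - (T′ - S′ + q * S)) + I * (r * (q * q) - (B′ - A′ + κ * (q * A)))
            ≈⟨ solve 11 (λ q S S′ T′ I κ A A′ B′ R r →
                (R :* (q :* q) :- (T′ :- S′ :+ q :* S)) :+ I :* (r :* (q :* q) :- (B′ :- A′ :+ κ :* (q :* A))) :=
                (R :+ I :* r) :* (q :* q) :- ((T′ :+ B′ :* I) :- (S′ :+ A′ :* I) :+ q :* (S :+ A :* (κ :* I)))) refl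
                q S S′ T′ I κ A A′ B′ R r ⟩
          (R + I * r) * (q * q) - ((T′ + B′ * I) - (S′ + A′ * I) + q * (S + A * (κ * I)))
            ≈⟨ +-congˡ (-‿cong (+-congˡ (*-congˡ (+-congˡ (*-congˡ (1/!-suc k)))))) ⟩
          (R + I * r) * (q * q) - ((T′ + B′ * I) - (S′ + A′ * I) + q * (S + A * 1/ k !)) ∎)
        where
        open SetoidReasoning setoid
        S = expSum a k
        S′ = expSum a (suc k)
        T′ = expSum b (suc k)
        I = 1/ suc k !
        κ = fromℕ (suc k)
        A = a ^ k
        A′ = a ^ suc k
        B′ = b ^ suc k
        R = taylorRemainder k
        r = remainder k

  open Step

  -- The discrete form of S' = S: each step of length q towards -Y
  -- multiplies the partial sum by 1 - q, up to an error of e q + C q².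
  expSum-descend : ∀ {Y q} → 0# ≤ q → q ≤ 1# → ∀ k j → fromℕ j * q ≤ Y →
    expSum (- (fromℕ j * q)) (suc k) ≤ 1# + fromℕ j * (q * term Y k + taylorRemainder Y k * (q * q))
  expSum-descend {Y} {q} 0≤q q≤1 k zero 0≤Y = ≤-respʳ-≈
    (solve 1 (λ z → con (+ 1) := con (+ 1) :+ con (+ 0) :* z) refl (q * term Y k + taylorRemainder Y k * (q * q)))
    (expSum-zero-≤1 (solve 1 (λ q → :- (con (+ 0) :* q) := con (+ 0)) refl q) (suc k))
  expSum-descend {Y} {q} 0≤q q≤1 k (suc j) [1+j]q≤Y =
    -- In the solver's letters, the Taylor bound reads `T′ ≤ (1 - q)(S + t) + q t + C q²`. The
    -- induction hypothesis bounds `S + t`, and `t ≤ e`. The last two summands are what the factor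
    -- `1 - q` saves; they are given away.
    difference
      (+-nonneg (+-nonneg (+-nonneg (+-nonneg (x≤y⇒0≤y-x taylor) (*-nonneg 0≤1-q (x≤y⇒0≤y-x (expSum-descend 0≤q q≤1 k j jq≤Y))))
        (*-nonneg 0≤q (x≤y⇒0≤y-x term≤)))
        (*-nonneg 0≤q (*-nonneg (fromℕ-nonneg j) (+-nonneg (*-nonneg 0≤q 0≤e) (*-nonneg 0≤C (*-nonneg 0≤q 0≤q))))))
        0≤q)
      (solve 7 (λ q κ S t T′ e C →
        ((((C :* (q :* q) :- (T′ :- (S :+ t) :+ q :* S)) :+
        (con (+ 1) :- q) :* ((con (+ 1) :+ κ :* (q :* e :+ C :* (q :* q))) :- (S :+ t))) :+
        q :* (e :- t)) :+ q :* (κ :* (q :* e :+ C :* (q :* q)))) :+ q :=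
        (con (+ 1) :+ (con (+ 1) :+ κ) :* (q :* e :+ C :* (q :* q))) :- T′) refl
        q (fromℕ j) (expSum a k) (term a k) (expSum b (suc k)) (term Y k) (taylorRemainder Y k))
    where
    a = - (fromℕ j * q)
    b = - (fromℕ (suc j) * q)
    0≤1-q = x≤y⇒0≤y-x q≤1
    0≤jq = *-nonneg (fromℕ-nonneg j) 0≤q
    0≤[1+j]q = *-nonneg (fromℕ-nonneg (suc j)) 0≤q
    jq≤Y : fromℕ j * q ≤ Y
    jq≤Y = ≤-trans (difference 0≤q (solve 2 (λ κ q → q := (con (+ 1) :+ κ) :* q :- κ :* q) refl (fromℕ j) q)) [1+j]q≤Y
    0≤Y : 0# ≤ Y
    0≤Y = ≤-trans 0≤jq jq≤Y
    0≤e : 0# ≤ term Y k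
    0≤e = *-nonneg (^-nonneg k 0≤Y) (1/!-nonneg k)
    0≤C : 0# ≤ taylorRemainder Y k
    0≤C = partialSum-nonneg (λ i → *-nonneg (1/!-nonneg (suc i)) (remainder-nonneg Y 0≤Y i)) k
    ∣-x∣≤Y : ∀ {x} → 0# ≤ x → x ≤ Y → ∣ - x ∣≤ Y
    ∣-x∣≤Y {x} 0≤x x≤Y = between (-‿anti-≤ x≤Y)
      (≤-trans (difference 0≤x (solve 1 (λ x → x := con (+ 0) :- (:- x)) refl x)) 0≤Y)
    taylor : expSum b (suc k) - expSum a (suc k) + q * expSum a k ≤ taylorRemainder Y k * (q * q)
    taylor = expSum-taylor Y
      (solve 2 (λ κ q → :- (κ :* q) := :- ((con (+ 1) :+ κ) :* q) :+ q) refl (fromℕ j) q)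
      (∣-x∣≤Y 0≤jq jq≤Y) (∣-x∣≤Y 0≤[1+j]q [1+j]q≤Y) k
    term≤ : term a k ≤ term Y k
    term≤ = upper (∣∣-* (∣∣-^ k (∣-x∣≤Y 0≤jq jq≤Y)) (nonneg⇒∣∣ (1/!-nonneg k)))

  -- The limit of `expSum-descend` for `q = Y / N` as `N` grows: the linear error stays
  -- `Y * term Y k` and the quadratic one vanishes. A positive gap `u` is refuted by one
  -- sufficiently large `N`.
  expSum-neg-≤ : ∀ {Y} → 0# < Y → ∀ k → expSum (- Y) (suc k) ≤ 1# + Y * term Y k
  expSum-neg-≤ {Y} 0<Y k = ≮⇒≥ λ gap →
    let u   = expSum (- Y) (suc k) - (1# + Y * term Y k)
        C   = taylorRemainder Y k
        N₁ , Y<N₁  = archimedean Y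
        N₂ , CY²<N₂u = archimedean-* (x<y⇒0<y-x gap) (C * (Y * Y))
        -- `N₁` ensures `q ≤ 1#`, `N₂` pushes the quadratic error below the gap, and `suc` keeps the
        -- divisor positive.
        N   = suc (N₁ ℕ.+ N₂)
        0<ν = fromℕ-pos (N₁ ℕ.+ N₂)
        ν   = fromℕ N
        q   = Y * ν ⁻¹
        0≤q = *-nonneg (<⇒≤ 0<Y) (<⇒≤ (⁻¹-pos 0<ν))
        νq≈Y : ν * q ≈ Y
        νq≈Y = trans (solve 3 (λ ν y i → ν :* (y :* i) := (ν :* i) :* y) refl ν Y (ν ⁻¹))
                 (trans (*-congʳ (⁻¹-inverse 0<ν)) (*-identityˡ Y))
        q≤1 : q ≤ 1#
        q≤1 = *-cancel-≤ 0<ν (≤-respˡ-≈ (sym νq≈Y) (≤-respʳ-≈ (sym (*-identityʳ ν))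
                (≤-trans (<⇒≤ Y<N₁) (fromℕ-mono (ℕ.m≤n⇒m≤1+n (ℕ.m≤m+n N₁ N₂))))))
        descend = ≤-respˡ-≈ (partialSum-cong (λ i → *-congʳ (^-congˡ i (-‿cong νq≈Y))) (suc k))
          (expSum-descend {Y} 0≤q q≤1 k N (≤-reflexive νq≈Y))
        descend′ : expSum (- Y) (suc k) ≤ 1# + (Y * term Y k + C * Y * q)
        descend′ = ≤-respʳ-≈ (+-congˡ (trans
          (solve 4 (λ ν q e C → ν :* (q :* e :+ C :* (q :* q)) := (ν :* q) :* e :+ C :* (ν :* q) :* q) refl ν q (term Y k) C)
          (+-cong (*-congʳ νq≈Y) (*-congʳ (*-congˡ νq≈Y))))) descend
        νu≤CY² : ν * u ≤ C * (Y * Y)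
        νu≤CY² = ≤-respʳ-≈ (trans (solve 4 (λ ν q C y → ν :* (C :* y :* q) := C :* (y :* (ν :* q))) refl ν q C Y)
            (*-congˡ (*-congˡ νq≈Y)))
          (*-monoˡ-≤ ν (<⇒≤ 0<ν) (difference (x≤y⇒0≤y-x descend′)
            (solve 3 (λ s e c → (con (+ 1) :+ (e :+ c)) :- s := c :- (s :- (con (+ 1) :+ e))) refl
              (expSum (- Y) (suc k)) (Y * term Y k) (C * Y * q))))
    in <⇒≱ CY²<N₂u (≤-trans
         (*-mono-≤ (fromℕ-nonneg N₂) (fromℕ-mono (ℕ.m≤n⇒m≤1+n (ℕ.m≤n+m N₂ N₁))) (<⇒≤ (x<y⇒0<y-x gap)) ≤-refl) νu≤CY²)

  ^-neg : ∀ x k → (- x) ^ k ≈ x ^ k ⊎ (- x) ^ k ≈ - (x ^ k)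
  ^-neg x zero    = inj₁ refl
  ^-neg x (suc k) with ^-neg x k
  ... | inj₁ eq = inj₂ (trans (*-congˡ eq) (solve 2 (λ x z → (:- x) :* z := :- (x :* z)) refl x (x ^ k)))
  ... | inj₂ eq = inj₁ (trans (*-congˡ eq) (solve 2 (λ x z → (:- x) :* (:- z) := x :* z) refl x (x ^ k)))

  -- By `^-neg` the two terms agree up to a sign that depends on the parity of `k`; a two-sided
  -- bound covers both cases.
  term-neg-≤ : ∀ {x c} k → ∣ term (- x) k ∣≤ c → term x k ≤ c
  term-neg-≤ {x} {c} k (between l u) with ^-neg x k
  ... | inj₁ eq = ≤-respˡ-≈ (*-congʳ eq) u
  ... | inj₂ eq = difference (x≤y⇒0≤y-x (≤-respʳ-≈ (*-congʳ eq) l))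
    (solve 3 (λ z i c → (:- z) :* i :- (:- c) := c :- z :* i) refl (x ^ k) (1/ k !) c)

  -- With it, ln n < 0 is impossible for n ≥ 2.
  exp-neg-< : ∀ {x y} → IsExp x y → x < 0# → y < fromℕ 2
  exp-neg-< {x} {y} isExp x<0 = ≰⇒> λ 2≤y →
    let Y   = - x
        0<Y = strict-difference (x<y⇒0<y-x x<0) (solve 1 (λ x → con (+ 0) :- x := (:- x) :- con (+ 0)) refl x)
        0<1+2Y : 0# < 1# + (Y + Y)
        0<1+2Y = +-pos 0<1 (+-nonneg (<⇒≤ 0<Y) (<⇒≤ 0<Y))
        -- Two consecutive partial sums within `δ` of `y` differ by at most `2δ`, which bounds the
        -- last term. Then `expSum-neg-≤` gives `y - δ < 1 + 2Yδ`, and `δ` is chosen so that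
        -- `(1 + 2Y)δ = 1`, that is, `y < 2`.
        δ   = (1# + (Y + Y)) ⁻¹
        0<δ = ⁻¹-pos 0<1+2Y
        N , close = isExp δ 0<δ
        x≈-Y : x ≈ - Y
        x≈-Y = solve 1 (λ x → x := :- (:- x)) refl x
        S≈ : ∀ k → sum {k} (λ i → term x (toℕ i)) ≈ expSum (- Y) k
        S≈ k = trans (sum≈partialSum (term x) k) (partialSum-cong (λ i → *-congʳ (^-congˡ i x≈-Y)) k)
        lo : y - δ ≤ expSum (- Y) N
        lo = ≤-respʳ-≈ (S≈ N) (<⇒≤ (proj₁ (close N ℕ.≤-refl)))
        hi : expSum (- Y) N ≤ y + δ
        hi = ≤-respˡ-≈ (S≈ N) (<⇒≤ (proj₂ (close N ℕ.≤-refl)))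
        lo′ : y - δ < expSum (- Y) (suc N)
        lo′ = <-≤-trans (proj₁ (close (suc N) (ℕ.n≤1+n N))) (≤-reflexive (S≈ (suc N)))
        hi′ : expSum (- Y) (suc N) ≤ y + δ
        hi′ = ≤-respˡ-≈ (S≈ (suc N)) (<⇒≤ (proj₂ (close (suc N) (ℕ.n≤1+n N))))
        S   = expSum (- Y) N
        t   = term (- Y) N
        ∣t∣≤2δ : ∣ t ∣≤ δ + δ
        ∣t∣≤2δ = between
          (difference (+-nonneg (x≤y⇒0≤y-x hi) (x≤y⇒0≤y-x (<⇒≤ lo′)))
            (solve 4 (λ y δ S t → ((y :+ δ) :- S) :+ ((S :+ t) :- (y :- δ)) := t :- (:- (δ :+ δ))) refl y δ S t))
          (difference (+-nonneg (x≤y⇒0≤y-x hi′) (x≤y⇒0≤y-x lo))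
            (solve 4 (λ y δ S t → ((y :+ δ) :- (S :+ t)) :+ (S :- (y :- δ)) := (δ :+ δ) :- t) refl y δ S t))
        1<1 : 1# < 1#
        1<1 = strict-difference
          (+-pos (x<y⇒0<y-x lo′) (+-nonneg (x≤y⇒0≤y-x 2≤y) (+-nonneg (x≤y⇒0≤y-x (expSum-neg-≤ 0<Y N))
            (*-nonneg (<⇒≤ 0<Y) (x≤y⇒0≤y-x (term-neg-≤ N ∣t∣≤2δ))))))
          (trans
            (solve 5 (λ y δ S′ Y e → (S′ :- (y :- δ)) :+ ((y :- num 2) :+ (((con (+ 1) :+ Y :* e) :- S′) :+ Y :* ((δ :+ δ) :- e))) :=
              (con (+ 1) :+ (Y :+ Y)) :* δ :- con (+ 1)) refl y δ (S + t) Y (term Y N))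
            (+-congʳ (⁻¹-inverse 0<1+2Y)))
    in <⇒≱ 1<1 ≤-refl

-- The numerical estimates of the tail bound.

module ChernoffFactor (em : ExcludedMiddle 0ℓ) (ℝ : CompleteOrderedField) where
  open CompleteOrderedField ℝ hiding (zero)
  open Analysis ℝ
  open RingSolving ℝ using (solve; con; num; _:+_; _:*_; _:-_; :-_; _:=_)
  open OrderedField em ℝ
  open Exponential em ℝ

  -- A counterpart of Bernoulli's inequality: multiplying `1 - (k + 1)z` by `1 + z` gives `1 - kz`
  -- less the square term `(k + 1)z²`.
  [1-kz][1+z]^k≤1 : ∀ {z} → 0# ≤ z → ∀ k → (1# - fromℕ k * z) * (1# + z) ^ k ≤ 1#
  [1-kz][1+z]^k≤1 {z} 0≤z zero = ≤-reflexive
    (solve 1 (λ z → (con (+ 1) :- con (+ 0) :* z) :* con (+ 1) := con (+ 1)) refl z)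
  [1-kz][1+z]^k≤1 {z} 0≤z (suc k) = ≤-trans
    (difference (*-nonneg (*-nonneg (fromℕ-nonneg (suc k)) (*-nonneg 0≤z 0≤z)) (^-nonneg k (+-nonneg 0≤1 0≤z)))
      (solve 3 (λ z κ E → ((con (+ 1) :+ κ) :* (z :* z)) :* E :=
        (con (+ 1) :- κ :* z) :* E :- (con (+ 1) :- (con (+ 1) :+ κ) :* z) :* ((con (+ 1) :+ z) :* E)) refl
        z (fromℕ k) ((1# + z) ^ k)))
    ([1-kz][1+z]^k≤1 0≤z k)

  2≤[9/8]^6 : ∀ {h} → fromℕ 8 * h ≈ 1# → 0# ≤ h → fromℕ 2 ≤ (1# + h) ^ 6
  2≤[9/8]^6 {h} 8h≈1 0≤h = difference
    (*-nonneg 0≤h³ (+-nonneg (+-nonneg (+-nonneg (fromℕ-nonneg 12) (*-nonneg (fromℕ-nonneg 15) 0≤h))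
      (*-nonneg (fromℕ-nonneg 6) (*-nonneg 0≤h 0≤h))) 0≤h³))
    (begin
      -- As `1 - 8h` vanishes, any multiple of it may be added; the multiple by `(1 + h)²` removes
      -- all terms of degree below three and leaves nonnegative coefficients.
      h * (h * h) * (fromℕ 12 + fromℕ 15 * h + fromℕ 6 * (h * h) + h * (h * h))
        ≈⟨ solve 1 (λ h → h :* (h :* h) :* (num 12 :+ num 15 :* h :+ num 6 :* (h :* h) :+ h :* (h :* h)) :=
             ((con (+ 1) :+ h) :* ((con (+ 1) :+ h) :* ((con (+ 1) :+ h) :* ((con (+ 1) :+ h) :* ((con (+ 1) :+ h) :* ((con (+ 1) :+ h) :* con (+ 1)))))) :- num 2)
             :+ ((con (+ 1) :+ h) :* (con (+ 1) :+ h)) :* (con (+ 1) :- num 8 :* h)) refl h ⟩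
      ((1# + h) ^ 6 - fromℕ 2) + (1# + h) * (1# + h) * (1# - fromℕ 8 * h)
        ≈⟨ +-congˡ (*-congˡ (+-congˡ (-‿cong 8h≈1))) ⟩
      ((1# + h) ^ 6 - fromℕ 2) + (1# + h) * (1# + h) * (1# - 1#)
        ≈⟨ solve 2 (λ a b → a :+ b :* (con (+ 1) :- con (+ 1)) := a) refl _ _ ⟩
      (1# + h) ^ 6 - fromℕ 2 ∎)
    where
    open SetoidReasoning setoid
    0≤h³ = *-nonneg 0≤h (*-nonneg 0≤h 0≤h)

  -- With y = 3q and z = y / 6r, Bernoulli's inequality gives (1 + z)^N ≥ 9/8.
  2^r-≤ : ∀ {q} N r → 0# ≤ q → fromℕ 3 * q ≤ 1# → fromℕ 2 * fromℕ r ≤ fromℕ 8 * q * fromℕ N →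
          (1# - fromℕ 3 * q) ^ N * fromℕ 2 ^ r ≤ 1#
  -- Separate because `z` below has `r` in its denominator.
  2^r-≤ {q} N zero 0≤q 3q≤1 _ = ≤-respˡ-≈ (sym (*-identityʳ _)) (^-≤1 N (x≤y⇒0≤y-x 3q≤1)
    (difference (*-nonneg (fromℕ-nonneg 3) 0≤q) (solve 1 (λ y → y := con (+ 1) :- (con (+ 1) :- y)) refl (fromℕ 3 * q))))
  2^r-≤ {q} N r@(suc r-1) 0≤q 3q≤1 2r≤8qN = ≤-trans
    -- Each factor 2 is at most `((1 + z)^N)^6`. Regrouped, `2^r` is bounded by `N` factors
    -- `(1 + z)^(6r)`, and each of these is absorbed by one factor `1 - y`, since `6rz = y`.
    (*-monoˡ-≤ ((1# - y) ^ N) (^-nonneg N 0≤1-y) (≤-trans (^-mono-≤ r (fromℕ-nonneg 2) 2≤v^6) (≤-reflexive powers)))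
    (≤-respˡ-≈ (^-distrib-* (1# - y) ((1# + z) ^ (6 ℕ.* r)) N)
      (^-≤1 N (*-nonneg 0≤1-y (^-nonneg (6 ℕ.* r) 0≤1+z))
        (≤-respˡ-≈ (*-congʳ (+-congˡ (-‿cong 6rz≈y))) ([1-kz][1+z]^k≤1 0≤z (6 ℕ.* r)))))
    where
    y = fromℕ 3 * q
    0≤1-y = x≤y⇒0≤y-x 3q≤1
    ρ = fromℕ r
    0<2ρ = *-pos (fromℕ-pos 1) (fromℕ-pos r-1)
    z = q * (fromℕ 2 * ρ) ⁻¹
    0≤z = *-nonneg 0≤q (<⇒≤ (⁻¹-pos 0<2ρ))
    0≤1+z = +-nonneg 0≤1 0≤z
    2ρz≈q : fromℕ 2 * ρ * z ≈ q
    2ρz≈q = trans (solve 3 (λ c q i → c :* (q :* i) := (c :* i) :* q) refl (fromℕ 2 * ρ) q ((fromℕ 2 * ρ) ⁻¹))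
      (trans (*-congʳ (⁻¹-inverse 0<2ρ)) (*-identityˡ q))
    6rz≈y : fromℕ (6 ℕ.* r) * z ≈ y
    6rz≈y = trans (*-congʳ (fromℕ-* 6 r)) (trans
      (solve 2 (λ ρ z → num 6 :* ρ :* z := num 3 :* (num 2 :* ρ :* z)) refl ρ z) (*-congˡ 2ρz≈q))
    h = fromℕ 8 ⁻¹
    1≤8Nz : 1# ≤ fromℕ 8 * (fromℕ N * z)
    1≤8Nz = *-cancel-≤ 0<2ρ (≤-respˡ-≈ (sym (*-identityʳ _)) (≤-respʳ-≈
      (trans (*-congʳ (*-congˡ (sym 2ρz≈q)))
        (solve 4 (λ e ρ z ν → e :* (num 2 :* ρ :* z) :* ν := num 2 :* ρ :* (e :* (ν :* z))) refl (fromℕ 8) ρ z (fromℕ N)))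
      2r≤8qN))
    h≤Nz : h ≤ fromℕ N * z
    h≤Nz = *-cancel-≤ (fromℕ-pos 7) (≤-respˡ-≈ (sym (⁻¹-inverse (fromℕ-pos 7))) 1≤8Nz)
    0≤h = <⇒≤ (⁻¹-pos (fromℕ-pos 7))
    2≤v^6 : fromℕ 2 ≤ ((1# + z) ^ N) ^ 6
    2≤v^6 = ≤-trans (2≤[9/8]^6 (⁻¹-inverse (fromℕ-pos 7)) 0≤h)
      (^-mono-≤ 6 (+-nonneg 0≤1 0≤h) (≤-trans (+-mono-≤ ≤-refl h≤Nz) (bernoulli N 0≤z)))
    powers : (((1# + z) ^ N) ^ 6) ^ r ≈ ((1# + z) ^ (6 ℕ.* r)) ^ N
    powers = begin
      (((1# + z) ^ N) ^ 6) ^ r      ≈⟨ ^-assocʳ _ 6 r ⟩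
      ((1# + z) ^ N) ^ (6 ℕ.* r)    ≈⟨ ^-assocʳ _ N (6 ℕ.* r) ⟩
      (1# + z) ^ (N ℕ.* (6 ℕ.* r))  ≡⟨ ≡.cong ((1# + z) ^_) (ℕ.*-comm N (6 ℕ.* r)) ⟩
      (1# + z) ^ ((6 ℕ.* r) ℕ.* N)  ≈⟨ ^-assocʳ _ (6 ℕ.* r) N ⟨
      ((1# + z) ^ (6 ℕ.* r)) ^ N    ∎
      where open SetoidReasoning setoid

  -- To be read with `x` = ln n, `y` = n and `q` = p/8. The factor `(1 - q)^N` absorbs `y`, and
  -- `(1 - 3q)^N` absorbs the power of two.
  chernoff-factor-≤ : ∀ {x y q} N r → IsExp x y → 0# ≤ x → 0# ≤ y → 0# ≤ q → fromℕ 8 * q ≤ 1# →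
    x ≤ fromℕ N * q → fromℕ 2 * fromℕ r ≤ fromℕ 8 * q * fromℕ N →
    y * (fromℕ 2 ^ r * (1# - fromℕ 4 * q) ^ N) ≤ 1#
  chernoff-factor-≤ {x} {y} {q} N r isExp 0≤x 0≤y 0≤q 8q≤1 x≤Nq 2r≤8qN = ≤-trans
    (*-monoˡ-≤ y 0≤y (*-monoˡ-≤ (fromℕ 2 ^ r) (^-nonneg r (fromℕ-nonneg 2)) (^-mono-≤ N (x≤y⇒0≤y-x (c*q≤1 4 4 ≡.refl)) split)))
    (≤-respˡ-≈
      (trans (solve 4 (λ a y b t → (a :* y) :* (b :* t) := y :* (t :* (a :* b))) refl
          ((1# - q) ^ N) y ((1# - fromℕ 3 * q) ^ N) (fromℕ 2 ^ r))
        (*-congˡ (*-congˡ (sym (^-distrib-* (1# - q) (1# - fromℕ 3 * q) N)))))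
      (≤-respʳ-≈ (*-identityˡ 1#) (*-mono-≤ (*-nonneg (^-nonneg N (x≤y⇒0≤y-x (<⇒≤ q<1))) 0≤y)
        (exp-≤ N isExp 0≤x 0≤q q<1 x≤Nq)
        (*-nonneg (^-nonneg N (x≤y⇒0≤y-x (c*q≤1 3 5 ≡.refl))) (^-nonneg r (fromℕ-nonneg 2)))
        (2^r-≤ N r 0≤q (c*q≤1 3 5 ≡.refl) 2r≤8qN))))
    where
    c*q≤1 : ∀ c d → c ℕ.+ d ≡ 8 → fromℕ c * q ≤ 1#
    c*q≤1 c d c+d≡8 = ≤-trans (difference (*-nonneg (fromℕ-nonneg d) 0≤q)
      (trans (solve 3 (λ c d q → d :* q := (c :+ d) :* q :- c :* q) refl (fromℕ c) (fromℕ d) q)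
        (+-congʳ (*-congʳ (sym (fromℕ-+ c d)))))) (≤-trans (≤-reflexive (*-congʳ (reflexive (≡.cong fromℕ c+d≡8)))) 8q≤1)
    q<1 : q < 1#
    q<1 = ≰⇒> λ 1≤q → <⇒≱ (strict-difference (fromℕ-pos 6) (solve 0 (num 7 := num 8 :- con (+ 1)) refl))
      (≤-trans (≤-respˡ-≈ (*-identityʳ _) (*-monoˡ-≤ (fromℕ 8) (fromℕ-nonneg 8) 1≤q)) 8q≤1)
    split : 1# - fromℕ 4 * q ≤ (1# - q) * (1# - fromℕ 3 * q)
    split = difference (*-nonneg (fromℕ-nonneg 3) (*-nonneg 0≤q 0≤q))
      (solve 1 (λ q → num 3 :* (q :* q) := (con (+ 1) :- q) :* (con (+ 1) :- num 3 :* q) :- (con (+ 1) :- num 4 :* q)) refl q)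

-- Limits of eventually constant sequences, and density of the rationals.

module Limits (em : ExcludedMiddle 0ℓ) (ℝ : CompleteOrderedField) where
  open CompleteOrderedField ℝ hiding (zero)
  open Analysis ℝ
  open RingSolving ℝ using (solve; con; _:+_; _:*_; _:-_; :-_; _:=_)
  open OrderedField em ℝ
  open PartialSums em ℝ

  eventually-const-⟶ : ∀ {a l} K → (∀ k → K ℕ.≤ k → a k ≈ l) → a ⟶ l
  eventually-const-⟶ {a} {l} K a≈l δ 0<δ = K , λ k K≤k →
    <-≤-trans (strict-difference 0<δ (solve 2 (λ δ l → δ := l :- (l :- δ)) refl δ l)) (≤-reflexive (sym (a≈l k K≤k))) ,
    ≤-<-trans (≤-reflexive (a≈l k K≤k)) (strict-difference 0<δ (solve 2 (λ δ l → δ := (l :+ δ) :- l) refl δ l))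

  eventually-const-limit : ∀ {a l c} K → a ⟶ l → (∀ k → K ℕ.≤ k → a k ≈ c) → l ≈ c
  eventually-const-limit {a} {l} {c} K a⟶l a≈c = ≤-antisym
    (≮⇒≥ λ c<l → let N , close = a⟶l (l - c) (x<y⇒0<y-x c<l) in
      <⇒≱ (proj₁ (close (K ℕ.⊔ N) (ℕ.m≤n⊔m K N)))
        (≤-reflexive (trans (a≈c _ (ℕ.m≤m⊔n K N)) (solve 2 (λ l c → c := l :- (l :- c)) refl l c))))
    (≮⇒≥ λ l<c → let N , close = a⟶l (c - l) (x<y⇒0<y-x l<c) in
      <⇒≱ (proj₂ (close (K ℕ.⊔ N) (ℕ.m≤n⊔m K N)))
        (≤-reflexive (trans (solve 2 (λ l c → l :+ (c :- l) := c) refl l c) (sym (a≈c _ (ℕ.m≤m⊔n K N))))))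

  partialSum-stable : ∀ {a} K → (∀ k → K ℕ.≤ k → a k ≈ 0#) → ∀ k → K ℕ.≤ k → partialSum a k ≈ partialSum a K
  partialSum-stable {a} K a≈0 k K≤k = go (ℕ.≤⇒≤′ K≤k)
    where
    go : ∀ {k} → K ℕ.≤′ k → partialSum a k ≈ partialSum a K
    go ℕ.≤′-refl        = refl
    go (ℕ.≤′-step K≤′k) = trans (+-cong (go K≤′k) (a≈0 _ (ℕ.≤′⇒≤ K≤′k))) (+-identityʳ _)

  finite-hasSum : ∀ {a} K → (∀ k → K ℕ.≤ k → a k ≈ 0#) → HasSum a (partialSum a K)
  finite-hasSum {a} K a≈0 = eventually-const-⟶ K λ k K≤k →
    trans (sum≈partialSum a k) (partialSum-stable K a≈0 k K≤k)

  finite-sum : ∀ {a l} K → HasSum a l → (∀ k → K ℕ.≤ k → a k ≈ 0#) → l ≈ partialSum a K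
  finite-sum {a} K hasSum a≈0 = eventually-const-limit K hasSum λ k K≤k →
    trans (sum≈partialSum a k) (partialSum-stable K a≈0 k K≤k)

  ceiling : ∀ {x} → 0# ≤ x → ∃[ k ] x ≤ fromℕ k × fromℕ k < x + 1#
  ceiling {x} 0≤x = let K , x<K = archimedean x in search K (<⇒≤ x<K)
    where
    search : ∀ K → x ≤ fromℕ K → ∃[ k ] x ≤ fromℕ k × fromℕ k < x + 1#
    search zero    x≤0 = 0 , x≤0 , <-≤-trans 0<1 (difference 0≤x (solve 1 (λ x → x := (x :+ con (+ 1)) :- con (+ 1)) refl x))
    search (suc K) x≤1+K with x ≤? fromℕ K
    ... | yes x≤K = search K x≤K
    ... | no  x≰K = suc K , x≤1+K , strict-difference (x<y⇒0<y-x (≰⇒> x≰K))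
      (solve 2 (λ x κ → x :- κ := (x :+ con (+ 1)) :- (con (+ 1) :+ κ)) refl x (fromℕ K))

  -- Subtracting fromℕ j reaches the negative numbers.
  rational : ℕ → ℕ → ℕ → Carrier
  rational N k j = fromℕ k * fromℕ (suc N) ⁻¹ - fromℕ j

  -- The grid of mesh `1 / suc N` is finer than the gap, and the shift by `j` makes `y` nonnegative,
  -- so that `ceiling` finds the first grid point not below `y`.
  rational-dense : ∀ {y z} → y < z → ∃[ N ] ∃[ k ] ∃[ j ] y ≤ rational N k j × rational N k j < z
  rational-dense {y} {z} y<z =
    let N , 1<Nu = archimedean-* (x<y⇒0<y-x y<z) 1#
        j , -y<j = archimedean (- y)
        k , lower , upper = ceiling (*-nonneg (fromℕ-nonneg (suc N)) (0≤y+j j (<⇒≤ -y<j)))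
    in N , k , j , y≤r N k j lower , r<z N k j (<⇒≤ 1<Nu) upper
    where
    0≤y+j : ∀ j → - y ≤ fromℕ j → 0# ≤ y + fromℕ j
    0≤y+j j -y≤j = difference (x≤y⇒0≤y-x -y≤j) (solve 2 (λ y j → j :- (:- y) := (y :+ j) :- con (+ 0)) refl y (fromℕ j))
    νr≈ : ∀ N k j → fromℕ (suc N) * rational N k j ≈ fromℕ k - fromℕ (suc N) * fromℕ j
    νr≈ N k j = trans (solve 4 (λ ν κ i j → ν :* (κ :* i :- j) := κ :* (ν :* i) :- ν :* j) refl
        (fromℕ (suc N)) (fromℕ k) (fromℕ (suc N) ⁻¹) (fromℕ j))
      (+-congʳ (trans (*-congˡ (⁻¹-inverse (fromℕ-pos N))) (*-identityʳ (fromℕ k))))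
    y≤r : ∀ N k j → fromℕ (suc N) * (y + fromℕ j) ≤ fromℕ k → y ≤ rational N k j
    y≤r N k j lower = *-cancel-≤ (fromℕ-pos N) (difference (x≤y⇒0≤y-x lower)
      (trans (solve 4 (λ κ ν y j → κ :- ν :* (y :+ j) := (κ :- ν :* j) :- ν :* y) refl (fromℕ k) (fromℕ (suc N)) y (fromℕ j))
        (+-congʳ (sym (νr≈ N k j)))))
    r<z : ∀ N k j → 1# ≤ fromℕ N * (z - y) → fromℕ k < fromℕ (suc N) * (y + fromℕ j) + 1# → rational N k j < z
    r<z N k j 1≤Nu upper = ≰⇒> λ z≤r → <⇒≱ upper (difference
      (+-nonneg (+-nonneg (x≤y⇒0≤y-x (*-monoˡ-≤ (fromℕ (suc N)) (fromℕ-nonneg (suc N)) z≤r)) (x≤y⇒0≤y-x 1≤Nu))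
        (x≤y⇒0≤y-x (<⇒≤ y<z)))
      (trans (+-congʳ (+-congʳ (+-congʳ (νr≈ N k j))))
        (solve 5 (λ κ ν y z j → (((κ :- (con (+ 1) :+ ν) :* j) :- (con (+ 1) :+ ν) :* z) :+ (ν :* (z :- y) :- con (+ 1))) :+ (z :- y) :=
          κ :- ((con (+ 1) :+ ν) :* (y :+ j) :+ con (+ 1))) refl (fromℕ k) (fromℕ N) y z (fromℕ j))))

-- Elementary measure theory.

module Measure (em : ExcludedMiddle 0ℓ) {ℝ : CompleteOrderedField} (𝒫 : ProbabilitySpace ℝ) where
  open CompleteOrderedField ℝ hiding (zero)
  open Analysis ℝ
  open RingSolving ℝ using (solve; con; num; _:+_; _:*_; _:-_; :-_; _:=_)
  open OrderedField em ℝ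
  open PartialSums em ℝ
  open Limits em ℝ
  open ProbabilitySpace 𝒫
  open Probability 𝒫

  dne : {A : Set} → ¬ ¬ A → A
  dne = decidable-stable em

  either : {A : Set₁} → A → A → ℕ → A
  either x y zero    = x
  either x y (suc _) = y

  ∪-closed : ∀ {A B} → Measurable A → Measurable B → Measurable (A ∪ B)
  ∪-closed {A} {B} mA mB = ≐-closed
    ((λ { (zero , a) → inj₁ a ; (suc _ , b) → inj₂ b }) , λ { (inj₁ a) → 0 , a ; (inj₂ b) → 1 , b })
    (⋃-closed (either A B) λ { zero → mA ; (suc _) → mB })

  ∩-closed : ∀ {A B} → Measurable A → Measurable B → Measurable (A ∩ B)
  ∩-closed mA mB = ≐-closed
    ((λ ¬∪ → dne (λ ¬a → ¬∪ (inj₁ ¬a)) , dne (λ ¬b → ¬∪ (inj₂ ¬b))) ,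
     λ { (a , b) (inj₁ ¬a) → ¬a a ; (a , b) (inj₂ ¬b) → ¬b b })
    (∁-closed (∪-closed (∁-closed mA) (∁-closed mB)))

  ∅-closed : Measurable ∅
  ∅-closed = ≐-closed ((λ ¬⊤ → ¬⊤ _) , λ ()) (∁-closed universe)

  -- By excluded middle, a condition that ignores the outcome is the universe or the empty event.
  const-closed : ∀ A → Measurable (λ _ → A)
  const-closed A with em {A}
  ... | yes a = ≐-closed ((λ _ → a) , _) universe
  ... | no ¬a = ≐-closed ((λ ()) , λ a → ⊥-elim (¬a a)) ∅-closed

  -- Countable additivity for the constant sequence `∅` makes the multiples of `ℙ ∅` converge to
  -- `ℙ ∅`. With tolerance `ℙ ∅` itself, if positive, late multiples would lie below twice `ℙ ∅`.
  ℙ-∅ : ℙ ∅ ≈ 0#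
  ℙ-∅ = ≤-antisym (≮⇒≥ λ 0<c →
      let N , close = additive (ℙ ∅) 0<c in
      <⇒≱ (proj₂ (close (2 ℕ.+ N) (ℕ.m≤n+m N 2)))
        (≤-respʳ-≈ (sym (multiple (2 ℕ.+ N)))
          (≤-respˡ-≈ (trans (solve 1 (λ c → num 2 :* c := c :+ c) refl (ℙ ∅)) (+-congʳ (sym ⋃∅)))
          (*-mono-≤ (fromℕ-nonneg 2) (fromℕ-mono {2} (ℕ.m≤m+n 2 N)) (<⇒≤ 0<c) ≤-refl))))
    (ℙ-nonneg ∅-closed)
    where
    additive = ℙ-additive (λ _ → ∅) (λ _ → ∅-closed) λ _ _ _ ()
    ⋃∅ : ℙ (⋃ ℕ (λ _ → ∅)) ≈ ℙ ∅
    ⋃∅ = ℙ-respects (⋃-closed _ λ _ → ∅-closed) ((λ ()) , λ ())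
    multiple : ∀ k → sum {k} (λ _ → ℙ ∅) ≈ fromℕ k * ℙ ∅
    multiple zero    = sym (zeroˡ _)
    multiple (suc k) = trans (+-congˡ (multiple k)) (solve 2 (λ κ c → c :+ κ :* c := (con (+ 1) :+ κ) :* c) refl (fromℕ k) (ℙ ∅))

  ℙ-empty : ∀ {A} → A ⊆ ∅ → ℙ A ≈ 0#
  ℙ-empty A⊆∅ = trans (sym (ℙ-respects ∅-closed ((λ ()) , A⊆∅))) ℙ-∅

  ℙ-∪ : ∀ {A B} → Measurable A → Measurable B → A ⊥ B → ℙ (A ∪ B) ≈ ℙ A + ℙ B
  ℙ-∪ {A} {B} mA mB A⊥B = begin
    ℙ (A ∪ B)               ≈⟨ ℙ-respects (∪-closed mA mB)
                                ((λ { (inj₁ a) → 0 , a ; (inj₂ b) → 1 , b }) ,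
                                 λ { (0 , a) → inj₁ a ; (1 , b) → inj₂ b ; (suc (suc _) , ()) }) ⟩
    ℙ (⋃ ℕ events)          ≈⟨ finite-sum {ℙ ∘ events} 2 (ℙ-additive events events-measurable disjoint)
                                (λ { (suc (suc k)) _ → ℙ-∅ ; 1 (ℕ.s≤s ()) }) ⟩
    (0# + ℙ A) + ℙ B        ≈⟨ +-congʳ (+-identityˡ _) ⟩
    ℙ A + ℙ B               ∎
    where
    open SetoidReasoning setoid
    events : ℕ → Pred Ω 0ℓ
    events 0 = A
    events 1 = B
    events (suc (suc _)) = ∅
    events-measurable : ∀ k → Measurable (events k)
    events-measurable 0 = mA
    events-measurable 1 = mB
    events-measurable (suc (suc _)) = ∅-closed
    disjoint : ∀ j k → j ≢ k → events j ⊥ events k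
    disjoint 0 0 j≢k = ⊥-elim (j≢k ≡.refl)
    disjoint 0 1 _ = A⊥B
    disjoint 1 0 _ (b , a) = A⊥B (a , b)
    disjoint 1 1 j≢k = ⊥-elim (j≢k ≡.refl)
    disjoint (suc (suc _)) _ _ (() , _)
    disjoint 0 (suc (suc _)) _ (_ , ())
    disjoint 1 (suc (suc _)) _ (_ , ())

  ℙ-split : ∀ {A B} → Measurable A → Measurable B → ℙ B ≈ ℙ (B ∩ A) + ℙ (B ∩ ∁ A)
  ℙ-split {A} {B} mA mB = trans
    (ℙ-respects mB ((λ {ω} b → split ω b) , λ { (inj₁ (b , _)) → b ; (inj₂ (b , _)) → b }))
    (ℙ-∪ (∩-closed mB mA) (∩-closed mB (∁-closed mA)) λ { ((_ , a) , (_ , ¬a)) → ¬a a })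
    where
    split : ∀ ω → B ω → (B ∩ A ∪ B ∩ ∁ A) ω
    split ω b with em {A ω}
    ... | yes a = inj₁ (b , a)
    ... | no ¬a = inj₂ (b , ¬a)

  ℙ-mono : ∀ {A B} → Measurable A → Measurable B → A ⊆ B → ℙ A ≤ ℙ B
  ℙ-mono {A} {B} mA mB A⊆B = difference (ℙ-nonneg (∩-closed mB (∁-closed mA)))
    (trans (solve 2 (λ a c → c := (a :+ c) :- a) refl (ℙ A) (ℙ (B ∩ ∁ A)))
      (+-congʳ (sym (trans (ℙ-split mA mB) (+-congʳ (ℙ-respects (∩-closed mB mA) (proj₂ , λ a → A⊆B a , a)))))))

  ℙ-∁ : ∀ {A} → Measurable A → ℙ (∁ A) ≈ 1# - ℙ A
  ℙ-∁ {A} mA = trans (solve 2 (λ a c → c := (a :+ c) :- a) refl (ℙ A) (ℙ (∁ A)))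
    (+-congʳ (sym (trans (sym ℙ-universe) (trans (ℙ-split mA universe)
      (+-cong (ℙ-respects (∩-closed universe mA) (proj₂ , (_ ,_)))
              (ℙ-respects (∩-closed universe (∁-closed mA)) (proj₂ , (_ ,_))))))))

  -- A sample outcome, at which facts holding for all outcomes can be read off and constant
  -- functions evaluated.
  nonempty : Ω
  nonempty = dne λ ¬Ω → 0≉1 (trans (sym (ℙ-empty {U} λ {ω} _ → ¬Ω ω)) ℙ-universe)

  -- Tests rays only, which suffices for comparisons and holds for constants without an induction
  -- over `Borel`.
  RayMeasurable : (Ω → Carrier) → Set₁
  RayMeasurable Y = ∀ a → Measurable (λ ω → Y ω ≤ a)

  rayMeasurable-cong : ∀ {Y Z} → (∀ ω → Y ω ≈ Z ω) → RayMeasurable Y → RayMeasurable Z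
  rayMeasurable-cong Y≈Z mY a = ≐-closed ((λ {ω} → ≤-respˡ-≈ (Y≈Z ω)) , λ {ω} → ≤-respˡ-≈ (sym (Y≈Z ω))) (mY a)

  rayMeasurable-const : ∀ {Y} → (∀ ω ω′ → Y ω ≈ Y ω′) → RayMeasurable Y
  rayMeasurable-const {Y} const a = ≐-closed ((λ {ω} → ≤-respˡ-≈ (const nonempty ω)) , λ {ω} → ≤-respˡ-≈ (const ω nonempty))
    (const-closed (Y nonempty ≤ a))

  -- `Y` is below `Z` exactly when some rational separates them, which is a countable union of
  -- events about one variable each; the three indices of `rational` give three nested unions.
  <-measurable : ∀ {Y Z} → RayMeasurable Y → RayMeasurable Z → Measurable (λ ω → Y ω < Z ω)
  <-measurable {Y} {Z} mY mZ = ≐-closed (separated⇒< , λ {ω} → <⇒separated ω)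
    (⋃-closed (λ N → ⋃ ℕ λ k → ⋃ ℕ (Separated N k)) λ N → ⋃-closed (λ k → ⋃ ℕ (Separated N k)) λ k →
      ⋃-closed (Separated N k) λ j → ∩-closed (mY (rational N k j)) (∁-closed (mZ (rational N k j))))
    where
    Separated : ℕ → ℕ → ℕ → Pred Ω 0ℓ
    Separated N k j ω = Y ω ≤ rational N k j × ¬ Z ω ≤ rational N k j
    separated⇒< : ∀ {ω} → ∃[ N ] ∃[ k ] ∃[ j ] Separated N k j ω → Y ω < Z ω
    separated⇒< (N , k , j , Y≤q , Z≰q) = ≤-<-trans Y≤q (≰⇒> Z≰q)
    <⇒separated : ∀ ω → Y ω < Z ω → ∃[ N ] ∃[ k ] ∃[ j ] Separated N k j ω
    <⇒separated ω Y<Z = let N , k , j , Y≤q , q<Z = rational-dense Y<Z in N , k , j , Y≤q , <⇒≱ q<Z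

-- Distribution and expectation of a sum of indicators.

module Counting (em : ExcludedMiddle 0ℓ) {ℝ : CompleteOrderedField} (𝒫 : ProbabilitySpace ℝ) {I : Set} where
  open CompleteOrderedField ℝ hiding (zero)
  open Analysis ℝ
  open RingSolving ℝ using (solve; con; _:+_; _:*_; _:=_)
  open OrderedField em ℝ
  open PartialSums em ℝ
  open Limits em ℝ
  open ProbabilitySpace 𝒫
  open Probability 𝒫
  open Measure em 𝒫

  module _ (ind : I → Ω → ℕ) (0-or-1 : ∀ i ω → ind i ω ≡ 0 ⊎ ind i ω ≡ 1) where

    On : I → Pred Ω 0ℓ
    On i ω = ind i ω ≡ 1

    off : ∀ {i ω} → ¬ On i ω → ind i ω ≡ 0
    off {i} {ω} ¬on = [ (λ eq → eq) , (λ eq → contradiction eq ¬on) ]′ (0-or-1 i ω)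

    count : List I → Ω → ℕ
    count is ω = ℕList.sum (map (λ i → ind i ω) is)

    count-on : ∀ {i ω} is → On i ω → count (i ∷ is) ω ≡ suc (count is ω)
    count-on {i} {ω} is on = ≡.cong (ℕ._+ count is ω) on

    count-off : ∀ {i ω} is → ¬ On i ω → count (i ∷ is) ω ≡ count is ω
    count-off {i} {ω} is ¬on = ≡.cong (ℕ._+ count is ω) (off ¬on)

    count≤length : ∀ is ω → count is ω ℕ.≤ length is
    count≤length []       ω = ℕ.z≤n
    count≤length (i ∷ is) ω = ℕ.+-mono-≤
      ([ (λ eq → ℕ.≤-trans (ℕ.≤-reflexive eq) ℕ.z≤n) , ℕ.≤-reflexive ]′ (0-or-1 i ω))
      (count≤length is ω)

    OnMeasurable : List I → Set₁
    OnMeasurable is = ∀ {i} → i ∈ˡ is → Measurable (On i)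

    count≡-measurable : ∀ is → OnMeasurable is → ∀ k → Measurable (λ ω → count is ω ≡ k)
    count≡-measurable []       mOn k = const-closed (0 ≡ k)
    count≡-measurable (i ∷ is) mOn k = ≐-closed (to , λ {ω} → from ω)
      (∪-closed (∩-closed mOn-i (increment k)) (∩-closed (∁-closed mOn-i) (count≡-measurable is (mOn ∘ there) k)))
      where
      mOn-i = mOn (here ≡.refl)
      increment : ∀ k → Measurable (λ ω → suc (count is ω) ≡ k)
      increment zero    = ≐-closed ((λ ()) , λ ()) ∅-closed
      increment (suc k) = ≐-closed (≡.cong suc , ℕ.suc-injective) (count≡-measurable is (mOn ∘ there) k)
      to : ∀ {ω} → (On i ω × suc (count is ω) ≡ k) ⊎ (¬ On i ω × count is ω ≡ k) → count (i ∷ is) ω ≡ k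
      to (inj₁ (on  , eq)) = ≡.trans (count-on is on) eq
      to (inj₂ (¬on , eq)) = ≡.trans (count-off is ¬on) eq
      from : ∀ ω → count (i ∷ is) ω ≡ k → (On i ω × suc (count is ω) ≡ k) ⊎ (¬ On i ω × count is ω ≡ k)
      from ω eq with em {On i ω}
      ... | yes on = inj₁ (on  , ≡.trans (≡.sym (count-on is on)) eq)
      ... | no ¬on = inj₂ (¬on , ≡.trans (≡.sym (count-off is ¬on)) eq)

    count-measurable : ∀ is → OnMeasurable is → (Q : ℕ → Set) → Measurable (λ ω → Q (count is ω))
    count-measurable is mOn Q = ≐-closed
      ((λ { (k , eq , q) → ≡.subst Q (≡.sym eq) q }) , λ {ω} q → count is ω , ≡.refl , q)
      (⋃-closed (λ k ω → count is ω ≡ k × Q k) λ k → ∩-closed (count≡-measurable is mOn k) (const-closed (Q k)))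

    -- Once `K` exceeds the length of `is`, the right side is `ℙ B`; with `B` the event `On i` this
    -- recovers `ℙ (On i)` in `moment-∷`.
    ℙ-count-partition : ∀ is → OnMeasurable is → ∀ {B} → Measurable B → ∀ K →
      partialSum (λ k → ℙ (λ ω → B ω × count is ω ≡ k)) K ≈ ℙ (λ ω → B ω × count is ω ℕ.< K)
    ℙ-count-partition is mOn {B} mB zero    = sym (ℙ-empty λ { (_ , ()) })
    ℙ-count-partition is mOn {B} mB (suc K) = trans (+-congʳ (ℙ-count-partition is mOn mB K)) (trans
      (sym (ℙ-∪ m< m≡ λ { ((_ , c<K) , (_ , c≡K)) → ℕ.<⇒≢ c<K c≡K }))
      (ℙ-respects (∪-closed m< m≡)
        ((λ { (inj₁ (b , c<K)) → b , ℕ.m<n⇒m<1+n c<K ; (inj₂ (b , c≡K)) → b , ℕ.s≤s (ℕ.≤-reflexive c≡K) }) ,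
         λ { (b , ℕ.s≤s c≤K) → [ (λ c<K → inj₁ (b , c<K)) , (λ c≡K → inj₂ (b , c≡K)) ]′ (ℕ.m≤n⇒m<n∨m≡n c≤K) })))
      where
      m< = ∩-closed mB (count-measurable is mOn (ℕ._< K))
      m≡ = ∩-closed mB (count≡-measurable is mOn K)

    moment : List I → ℕ → Carrier
    moment is = partialSum λ k → fromℕ k * ℙ (λ ω → count is ω ≡ k)

    -- Linearity of expectation on the level of distributions. The count is `suc k` if `i` is on and
    -- the rest count `k`, or if `i` is off and the rest count `suc k`; splitting the weight `suc k`
    -- of the first case into `k` and 1 leaves the sum of all `β k`, which is `ℙ (On i)`.
    moment-∷ : ∀ i is → OnMeasurable (i ∷ is) → ∀ K → length is ℕ.< K →
      moment (i ∷ is) (suc K) ≈ moment is K + ℙ (On i)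
    moment-∷ i is mOn K len<K = begin
      partialSum (λ k → fromℕ k * ℙ (λ ω → count (i ∷ is) ω ≡ k)) (suc K)
        ≈⟨ partialSum-head (λ k → fromℕ k * ℙ (λ ω → count (i ∷ is) ω ≡ k)) K ⟩
      0# * ℙ (λ ω → count (i ∷ is) ω ≡ 0) + partialSum (λ k → fromℕ (suc k) * ℙ (λ ω → count (i ∷ is) ω ≡ suc k)) K
        ≈⟨ trans (+-congʳ (zeroˡ _)) (+-identityˡ _) ⟩
      partialSum (λ k → fromℕ (suc k) * ℙ (λ ω → count (i ∷ is) ω ≡ suc k)) K
        ≈⟨ partialSum-cong (λ k → trans (*-congˡ (ℙ-suc k))
             (solve 3 (λ κ b c → (con (+ 1) :+ κ) :* (b :+ c) := (κ :* b :+ (con (+ 1) :+ κ) :* c) :+ b) refl (fromℕ k) (β k) (γ (suc k)))) K ⟩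
      partialSum (λ k → (fromℕ k * β k + fromℕ (suc k) * γ (suc k)) + β k) K
        ≈⟨ partialSum-+ (λ k → fromℕ k * β k + fromℕ (suc k) * γ (suc k)) β K ⟩
      partialSum (λ k → fromℕ k * β k + fromℕ (suc k) * γ (suc k)) K + partialSum β K
        ≈⟨ +-congʳ (partialSum-+ (λ k → fromℕ k * β k) (λ k → fromℕ (suc k) * γ (suc k)) K) ⟩
      (partialSum (λ k → fromℕ k * β k) K + partialSum (λ k → fromℕ (suc k) * γ (suc k)) K) + partialSum β K
        ≈⟨ +-cong (+-congˡ shift) (trans (ℙ-count-partition is mOn′ mOn-i K)
             (ℙ-respects (∩-closed mOn-i (count-measurable is mOn′ (ℕ._< K))) (proj₁ , λ {ω} on → on , count<K ω))) ⟩
      (partialSum (λ k → fromℕ k * β k) K + partialSum (λ k → fromℕ k * γ k) K) + ℙ (On i)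
        ≈⟨ +-congʳ (trans (sym (partialSum-+ (λ k → fromℕ k * β k) (λ k → fromℕ k * γ k) K))
             (partialSum-cong (λ k → trans (sym (distribˡ (fromℕ k) (β k) (γ k))) (*-congˡ (sym (ℙ-split′ k)))) K)) ⟩
      moment is K + ℙ (On i) ∎
      where
      open SetoidReasoning setoid
      mOn-i = mOn (here ≡.refl)
      mOn′ : OnMeasurable is
      mOn′ = mOn ∘ there
      β γ : ℕ → Carrier
      β k = ℙ (λ ω → On i ω × count is ω ≡ k)
      γ k = ℙ (λ ω → ¬ On i ω × count is ω ≡ k)
      count<K : ∀ ω → count is ω ℕ.< K
      count<K ω = ℕ.≤-<-trans (count≤length is ω) len<K
      γ-K : γ K ≈ 0#
      γ-K = ℙ-empty λ {ω} (_ , c≡K) → ℕ.<⇒≢ (count<K ω) c≡K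
      -- The left side lacks the term at 0, which has weight zero, and has in addition the term at
      -- `K`, whose event is empty.
      shift : partialSum (λ k → fromℕ (suc k) * γ (suc k)) K ≈ partialSum (λ k → fromℕ k * γ k) K
      shift = begin
        partialSum (λ k → fromℕ (suc k) * γ (suc k)) K       ≈⟨ trans (+-congʳ (zeroˡ (γ 0))) (+-identityˡ _) ⟨
        0# * γ 0 + partialSum (λ k → fromℕ (suc k) * γ (suc k)) K  ≈⟨ partialSum-head (λ k → fromℕ k * γ k) K ⟨
        partialSum (λ k → fromℕ k * γ k) K + fromℕ K * γ K   ≈⟨ +-congˡ (trans (*-congˡ γ-K) (zeroʳ _)) ⟩
        partialSum (λ k → fromℕ k * γ k) K + 0#              ≈⟨ +-identityʳ _ ⟩
        partialSum (λ k → fromℕ k * γ k) K                   ∎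
      ℙ-split′ : ∀ k → ℙ (λ ω → count is ω ≡ k) ≈ β k + γ k
      ℙ-split′ k = trans (ℙ-split mOn-i mk)
        (+-cong (ℙ-respects (∩-closed mk mOn-i) ((λ (c , o) → o , c) , λ (o , c) → c , o))
                (ℙ-respects (∩-closed mk (∁-closed mOn-i)) ((λ (c , o) → o , c) , λ (o , c) → c , o)))
        where mk = count≡-measurable is mOn′ k
      ℙ-suc : ∀ k → ℙ (λ ω → count (i ∷ is) ω ≡ suc k) ≈ β k + γ (suc k)
      ℙ-suc k = trans (ℙ-split mOn-i mk) (+-cong
        (ℙ-respects (∩-closed mk mOn-i)
          ((λ (c , on) → on , ℕ.suc-injective (≡.trans (≡.sym (count-on is on)) c)) ,
           λ (on , c) → ≡.trans (count-on is on) (≡.cong suc c) , on))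
        (ℙ-respects (∩-closed mk (∁-closed mOn-i))
          ((λ (c , ¬on) → ¬on , ≡.trans (≡.sym (count-off is ¬on)) c) ,
           λ (¬on , c) → ≡.trans (count-off is ¬on) c , ¬on)))
        where mk = count≡-measurable (i ∷ is) mOn (suc k)

    moment-≥ : ∀ {p} is → OnMeasurable is → (∀ {i} → i ∈ˡ is → p ≤ ℙ (On i)) →
      p * fromℕ (length is) ≤ moment is (suc (length is))
    moment-≥ {p} []       mOn p≤ = ≤-reflexive
      (solve 2 (λ p a → p :* con (+ 0) := con (+ 0) :+ con (+ 0) :* a) refl p (ℙ (λ ω → 0 ≡ 0)))
    moment-≥ {p} (i ∷ is) mOn p≤ = ≤-respʳ-≈ (sym (moment-∷ i is mOn (suc (length is)) ℕ.≤-refl))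
      (≤-respˡ-≈ (solve 2 (λ p n → p :* n :+ p := p :* (con (+ 1) :+ n)) refl p (fromℕ (length is)))
        (+-mono-≤ (moment-≥ is (mOn ∘ there) (p≤ ∘ there)) (p≤ (here ≡.refl))))

    count-expectation : ∀ is → OnMeasurable is → IsExpectation (count is) (moment is (suc (length is)))
    count-expectation is mOn = record
      { measurable = count≡-measurable is mOn
      ; hasSum     = finite-hasSum {λ k → fromℕ k * ℙ (λ ω → count is ω ≡ k)} (suc (length is)) λ k len<k →
          trans (*-congˡ (ℙ-empty λ {ω} c≡k → ℕ.<⇒≢ (ℕ.≤-<-trans (count≤length is ω) len<k) c≡k)) (zeroʳ (fromℕ k))
      }

-- The lower tail for independent variables.

module LowerTail (em : ExcludedMiddle 0ℓ) {ℝ : CompleteOrderedField} (𝒫 : ProbabilitySpace ℝ) {I : Set} where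
  open CompleteOrderedField ℝ hiding (zero)
  open Analysis ℝ
  open RingSolving ℝ using (solve; con; num; _:+_; _:*_; _:-_; :-_; _:=_)
  open OrderedField em ℝ
  open ProbabilitySpace 𝒫
  open Probability 𝒫
  open Measure em 𝒫
  open Counting em 𝒫 {I}

  AllMeasurable : List I → (I → Ω → Carrier) → Set₁
  AllMeasurable is Y = ∀ {i} → i ∈ˡ is → IsRandomVariable (Y i)

  module _ (Y : I → Ω → Carrier) where

    allEvent : (I → Pred Carrier 0ℓ) → List I → Pred Ω 0ℓ
    allEvent S is ω = All (λ i → S i (Y i ω)) is

    -- The invariant of the induction in `lower-tail`: `C` records what was decided about the
    -- variables already removed. Conditioning is multiplied out, so `ℙ C` may be zero.
    IndependentOf : Pred Ω 0ℓ → List I → Set₁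
    IndependentOf C is = (S : I → Pred Carrier 0ℓ) → (∀ i → Borel (S i)) →
      ℙ (λ ω → C ω × allEvent S is ω) ≈ ℙ C * ∏ (map (λ i → ℙ (S i ∘ Y i)) is)

    allEvent-measurable : ∀ {S} is → AllMeasurable is Y → (∀ i → Borel (S i)) → Measurable (allEvent S is)
    allEvent-measurable []       rv bS = ≐-closed ((λ _ → []) , _) universe
    allEvent-measurable (i ∷ is) rv bS = ≐-closed ((λ (s , ss) → s ∷ ss) , λ { (s ∷ ss) → s , ss })
      (∩-closed (rv (here ≡.refl) _ (bS i)) (allEvent-measurable is (rv ∘ there) bS))

    -- U itself has no evident derivation as a Borel set.
    whole : Pred Carrier 0ℓ
    whole = ⋃ ℕ λ k → λ x → x ≤ fromℕ k

    whole-Borel : Borel whole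
    whole-Borel = union (λ k x → x ≤ fromℕ k) λ k → ray (fromℕ k)

    ∈whole : ∀ x → whole x
    ∈whole x = let k , x<k = archimedean x in k , <⇒≤ x<k

    ℙ-whole : ∀ is → ∏ (map (λ i → ℙ (whole ∘ Y i)) is) ≈ 1#
    ℙ-whole []       = refl
    ℙ-whole (i ∷ is) = trans (*-cong
      (trans (sym (ℙ-respects universe ((λ {ω} _ → ∈whole (Y i ω)) , _))) ℙ-universe) (ℙ-whole is)) (*-identityˡ 1#)

    -- Choosing `T` as the set for `i` moves the head variable from the list into the event. That
    -- `i` does not recur in `is` leaves the sets of the remaining variables free.
    refine : ∀ {C T i is} → Measurable C → Borel T → AllMeasurable (i ∷ is) Y → All (i ≢_) is →
      IndependentOf C (i ∷ is) →
      IndependentOf (C ∩ (T ∘ Y i)) is × ℙ (C ∩ (T ∘ Y i)) ≈ ℙ C * ℙ (T ∘ Y i)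
    refine {C} {T} {i} {is} mC bT rv i∉is indep = indep′ , ℙ-C∩T
      where
      open SetoidReasoning setoid
      mT = rv (here ≡.refl) _ bT
      override : (I → Pred Carrier 0ℓ) → I → Pred Carrier 0ℓ
      override S j with em {i ≡ j}
      ... | yes _ = T
      ... | no  _ = S j
      override-i : ∀ S → override S i ≡ T
      override-i S with em {i ≡ i}
      ... | yes _  = ≡.refl
      ... | no i≢i = contradiction ≡.refl i≢i
      override-≢ : ∀ S {j} → i ≢ j → override S j ≡ S j
      override-≢ S {j} i≢j with em {i ≡ j}
      ... | yes i≡j = contradiction i≡j i≢j
      ... | no  _   = ≡.refl
      override-Borel : ∀ S → (∀ j → Borel (S j)) → ∀ j → Borel (override S j)
      override-Borel S bS j with em {i ≡ j}
      ... | yes _ = bT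
      ... | no  _ = bS j
      to : ∀ S {ω} → (C ω × T (Y i ω)) × allEvent S is ω → C ω × allEvent (override S) (i ∷ is) ω
      to S {ω} ((c , t) , ss) = c , ≡.subst (λ R → R (Y i ω)) (≡.sym (override-i S)) t ∷
        All.zipWith (λ {j} (i≢j , s) → ≡.subst (λ R → R (Y j ω)) (≡.sym (override-≢ S i≢j)) s) (i∉is , ss)
      from : ∀ S {ω} → C ω × allEvent (override S) (i ∷ is) ω → (C ω × T (Y i ω)) × allEvent S is ω
      from S {ω} (c , s ∷ ss) = (c , ≡.subst (λ R → R (Y i ω)) (override-i S) s) ,
        All.zipWith (λ {j} (i≢j , s) → ≡.subst (λ R → R (Y j ω)) (override-≢ S i≢j) s) (i∉is , ss)
      joint : ∀ S → (∀ j → Borel (S j)) →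
        ℙ (λ ω → (C ω × T (Y i ω)) × allEvent S is ω) ≈ ℙ C * ℙ (T ∘ Y i) * ∏ (map (λ j → ℙ (S j ∘ Y j)) is)
      joint S bS = begin
        ℙ (λ ω → (C ω × T (Y i ω)) × allEvent S is ω)
          ≈⟨ ℙ-respects (∩-closed (∩-closed mC mT) (allEvent-measurable is (rv ∘ there) bS))
               ((λ {ω} → to S {ω}) , λ {ω} → from S {ω}) ⟩
        ℙ (λ ω → C ω × allEvent (override S) (i ∷ is) ω)
          ≈⟨ indep (override S) (override-Borel S bS) ⟩
        ℙ C * (ℙ (override S i ∘ Y i) * ∏ (map (λ j → ℙ (override S j ∘ Y j)) is))
          ≡⟨ ≡.cong₂ (λ R xs → ℙ C * (ℙ (R ∘ Y i) * ∏ xs)) (override-i S)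
               (map-cong-local (All.map (λ {j} i≢j → ≡.cong (λ R → ℙ (R ∘ Y j)) (override-≢ S i≢j)) i∉is)) ⟩
        ℙ C * (ℙ (T ∘ Y i) * ∏ (map (λ j → ℙ (S j ∘ Y j)) is))
          ≈⟨ *-assoc _ _ _ ⟨
        ℙ C * ℙ (T ∘ Y i) * ∏ (map (λ j → ℙ (S j ∘ Y j)) is) ∎
      ℙ-C∩T : ℙ (C ∩ (T ∘ Y i)) ≈ ℙ C * ℙ (T ∘ Y i)
      ℙ-C∩T = begin
        ℙ (C ∩ (T ∘ Y i))
          ≈⟨ ℙ-respects (∩-closed mC mT) ((λ {ω} ct → ct , All.universal (λ j → ∈whole (Y j ω)) is) , proj₁) ⟩
        ℙ (λ ω → (C ω × T (Y i ω)) × allEvent (λ _ → whole) is ω)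
          ≈⟨ joint (λ _ → whole) (λ _ → whole-Borel) ⟩
        ℙ C * ℙ (T ∘ Y i) * ∏ (map (λ j → ℙ (whole ∘ Y j)) is)
          ≈⟨ trans (*-congˡ (ℙ-whole is)) (*-identityʳ _) ⟩
        ℙ C * ℙ (T ∘ Y i) ∎
      indep′ : IndependentOf (C ∩ (T ∘ Y i)) is
      indep′ S bS = trans (joint S bS) (*-congʳ (sym ℙ-C∩T))

    module _ (P : Carrier) where

      Exceeds : I → Pred Ω 0ℓ
      Exceeds i ω = ¬ Y i ω ≤ P

      exceeds : I → Ω → ℕ
      exceeds i ω = if does (Y i ω ≤? P) then 0 else 1

      exceeds-0-or-1 : ∀ i ω → exceeds i ω ≡ 0 ⊎ exceeds i ω ≡ 1
      exceeds-0-or-1 i ω with does (Y i ω ≤? P)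
      ... | true  = inj₁ ≡.refl
      ... | false = inj₂ ≡.refl

      exceeds⇔ : ∀ {i ω} → (exceeds i ω ≡ 1 → Exceeds i ω) × (Exceeds i ω → exceeds i ω ≡ 1)
      exceeds⇔ {i} {ω} with Y i ω ≤? P
      ... | yes y≤P = (λ ()) , contradiction y≤P
      ... | no  y≰P = (λ _ → y≰P) , λ _ → ≡.refl

      exceedances : List I → Ω → ℕ
      exceedances = count exceeds exceeds-0-or-1

      exceeds-measurable : ∀ is → AllMeasurable is Y → OnMeasurable exceeds exceeds-0-or-1 is
      exceeds-measurable is rv i∈is = ≐-closed (proj₂ exceeds⇔ , proj₁ exceeds⇔) (rv i∈is _ (complement (ray P)))

      module _ {i is} {C : Pred Ω 0ℓ} (mC : Measurable C) (rv : AllMeasurable (i ∷ is) Y)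
               (i∉is : All (i ≢_) is) (indep : IndependentOf C (i ∷ is)) where

        low : ℕ → Pred Ω 0ℓ
        low r ω = C ω × exceedances (i ∷ is) ω ℕ.≤ r

        low-measurable : ∀ r → Measurable (low r)
        low-measurable r = ∩-closed mC
          (count-measurable exceeds exceeds-0-or-1 (i ∷ is) (exceeds-measurable (i ∷ is) rv) (ℕ._≤ r))

        -- One branch of the case distinction in `lower-tail`: `T` is the ray up to `P` with
        -- `r′ = r`, or its complement with `r′` one less than `r`.
        low-∩-≤ : ∀ {T r r′ w} → Borel T →
          (∀ {ω} → T (Y i ω) → exceedances (i ∷ is) ω ℕ.≤ r → exceedances is ω ℕ.≤ r′) →
          ℙ (λ ω → (C ∩ (T ∘ Y i)) ω × exceedances is ω ℕ.≤ r′) ≤ fromℕ 2 ^ r′ * (ℙ (C ∩ (T ∘ Y i)) * w) →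
          ℙ (low r ∩ (T ∘ Y i)) ≤ fromℕ 2 ^ r′ * (ℙ C * ℙ (T ∘ Y i) * w)
        low-∩-≤ {T} {r} {r′} bT fewer bound = ≤-trans
          (ℙ-mono (∩-closed (low-measurable r) mT)
            (∩-closed (∩-closed mC mT)
              (count-measurable exceeds exceeds-0-or-1 is (exceeds-measurable is (rv ∘ there)) (ℕ._≤ r′)))
            λ ((c , e) , t) → (c , t) , fewer t e)
          (≤-respʳ-≈ (*-congˡ (*-congʳ (proj₂ (refine mC bT rv i∉is indep)))) bound)
          where mT = rv (here ≡.refl) _ bT

      -- The exponential-moment method with E[2^(-count)], computed one
      -- variable at a time by conditioning on whether it exceeds P.
      lower-tail : ∀ {s} → 0# ≤ s → s ≤ 1# → ∀ is C r → Measurable C → AllMeasurable is Y → Unique is → IndependentOf C is →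
        (∀ {i} → i ∈ˡ is → fromℕ 2 * s ≤ ℙ (Exceeds i)) →
        ℙ (λ ω → C ω × exceedances is ω ℕ.≤ r) ≤ fromℕ 2 ^ r * (ℙ C * (1# - s) ^ length is)
      lower-tail {s} 0≤s s≤1 [] C r mC rv _ _ _ = ≤-trans
        (ℙ-mono (∩-closed mC (const-closed (0 ℕ.≤ r))) mC proj₁)
        (≤-respˡ-≈ (trans (*-identityˡ _) (*-identityʳ (ℙ C)))
          (*-mono-≤ 0≤1 (≤-respˡ-≈ (1^k≈1 r) (^-mono-≤ r 0≤1 1≤2)) (*-nonneg (ℙ-nonneg mC) 0≤1) ≤-refl))
        where
        1≤2 : 1# ≤ fromℕ 2
        1≤2 = difference 0≤1 (solve 0 (con (+ 1) := num 2 :- con (+ 1)) refl)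
      lower-tail {s} 0≤s s≤1 (i ∷ is) C r mC rv (i∉is ∷ unique) indep large =
        ≤-respˡ-≈ (sym (ℙ-split mBelow (low-measurable mC rv i∉is indep r))) (bound r)
        where
        mBelow = rv (here ≡.refl) _ (ray P)
        W = (1# - s) ^ length is
        0≤W = ^-nonneg (length is) (x≤y⇒0≤y-x s≤1)
        l = ℙ (λ ω → Y i ω ≤ P)
        2s≤1-l : fromℕ 2 * s ≤ 1# - l
        2s≤1-l = ≤-respʳ-≈ (ℙ-∁ mBelow) (large (here ≡.refl))
        recurse : ∀ {T} → Borel T → ∀ r → ℙ (λ ω → (C ∩ (T ∘ Y i)) ω × exceedances is ω ℕ.≤ r) ≤
                                      fromℕ 2 ^ r * (ℙ (C ∩ (T ∘ Y i)) * W)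
        recurse {T} bT r = lower-tail 0≤s s≤1 is (C ∩ (T ∘ Y i)) r (∩-closed mC (rv (here ≡.refl) _ bT)) (rv ∘ there) unique
          (proj₁ (refine mC bT rv i∉is indep)) (large ∘ there)
        below : ∀ r → ℙ (low mC rv i∉is indep r ∩ (λ ω → Y i ω ≤ P)) ≤ fromℕ 2 ^ r * (ℙ C * l * W)
        below r = low-∩-≤ mC rv i∉is indep (ray P)
          (λ {ω} y≤P → ≡.subst (ℕ._≤ r) (count-off exceeds exceeds-0-or-1 is λ on → proj₁ exceeds⇔ on y≤P))
          (recurse (ray P) r)
        above : ∀ r → ℙ (low mC rv i∉is indep (suc r) ∩ Exceeds i) ≤ fromℕ 2 ^ r * (ℙ C * ℙ (Exceeds i) * W)
        above r = low-∩-≤ mC rv i∉is indep (complement (ray P))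
          (λ {ω} y≰P e≤1+r → ℕ.≤-pred (≡.subst (ℕ._≤ suc r) (count-on exceeds exceeds-0-or-1 is (proj₂ exceeds⇔ y≰P)) e≤1+r))
          (recurse (complement (ray P)) r)
        above-0 : ℙ (low mC rv i∉is indep 0 ∩ Exceeds i) ≈ 0#
        above-0 = ℙ-empty λ {ω} ((_ , e≤0) , y≰P) →
          ℕ.1+n≢0 (ℕ.n≤0⇒n≡0 (≡.subst (ℕ._≤ 0) (count-on exceeds exceeds-0-or-1 is (proj₂ exceeds⇔ y≰P)) e≤0))
        bound : ∀ r → ℙ (low mC rv i∉is indep r ∩ (λ ω → Y i ω ≤ P)) + ℙ (low mC rv i∉is indep r ∩ Exceeds i) ≤
                      fromℕ 2 ^ r * (ℙ C * ((1# - s) * W))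
        -- With no exceedance allowed, the branch above `P` is empty, and `l ≤ 1 - 2s` is more than
        -- enough.
        bound zero = ≤-trans (+-mono-≤ (below 0) (≤-reflexive above-0))
          (difference (*-nonneg (*-nonneg (ℙ-nonneg mC) 0≤W) (+-nonneg (x≤y⇒0≤y-x 2s≤1-l) 0≤s))
            (solve 4 (λ c w l s → c :* w :* (((con (+ 1) :- l) :- num 2 :* s) :+ s) :=
              con (+ 1) :* (c :* ((con (+ 1) :- s) :* w)) :- (con (+ 1) :* (c :* l :* w) :+ con (+ 0))) refl (ℙ C) W l s))
        -- The branch above `P` uses up one exceedance and so comes with half the power of two:
        -- `l + (1 - l)/2 = 1 - (1 - l)/2 ≤ 1 - s`.
        bound (suc r) = ≤-trans (+-mono-≤ (below (suc r)) (above r))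
          (difference (*-nonneg (*-nonneg (^-nonneg r (fromℕ-nonneg 2)) (*-nonneg (ℙ-nonneg mC) 0≤W)) (x≤y⇒0≤y-x 2s≤1-l))
            (trans
              (solve 5 (λ t c w l s → t :* (c :* w) :* ((con (+ 1) :- l) :- num 2 :* s) :=
                num 2 :* t :* (c :* ((con (+ 1) :- s) :* w)) :- (num 2 :* t :* (c :* l :* w) :+ t :* (c :* (con (+ 1) :- l) :* w))) refl
                (fromℕ 2 ^ r) (ℙ C) W l s)
              (+-congˡ (-‿cong (+-congˡ (*-congˡ (*-congʳ (*-congˡ (sym (ℙ-∁ mBelow))))))))))

-- What a search prunes.

module Pruning (em : ExcludedMiddle 0ℓ) (ℝ : CompleteOrderedField) {n : ℕ} (G : Network n)
               (P : CompleteOrderedField.Carrier ℝ) where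
  open CompleteOrderedField ℝ hiding (zero)
  open OrderedField em ℝ
  open Min totalOrder using (x⊓y≤x; x⊓y≤y; ⊓-sel)
  open Network G
  open Search ℝ G
  open DijkstraPrediction P

  -- Dissolves the running minimum into single comparisons, the form in which the bound is shown
  -- measurable.
  >∞-⊓∞ : ∀ {x y b} → (x >∞ just (y ⊓∞ b) → y < x ⊎ x >∞ b) × (y < x ⊎ x >∞ b → x >∞ just (y ⊓∞ b))
  >∞-⊓∞ {x} {y} {nothing} =
    (λ { (_ , ≡.refl , y<x) → inj₁ y<x }) , λ { (inj₁ y<x) → _ , ≡.refl , y<x ; (inj₂ (_ , () , _)) }
  >∞-⊓∞ {x} {y} {just b} =
    (λ { (_ , ≡.refl , min<x) →
      [ (λ eq → inj₁ (≤-<-trans (≤-reflexive (sym eq)) min<x)) ,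
        (λ eq → inj₂ (b , ≡.refl , ≤-<-trans (≤-reflexive (sym eq)) min<x)) ]′ (⊓-sel y b) }) ,
    λ { (inj₁ y<x) → _ , ≡.refl , ≤-<-trans (x⊓y≤x y b) y<x
      ; (inj₂ (_ , ≡.refl , b<x)) → _ , ≡.refl , ≤-<-trans (x⊓y≤y y b) b<x }

  -- The local B of scanEdge.
  newBound : Weights → Vertex → Carrier → State → Vertex → Carrier∞
  newBound w u x σ v = if does (v ∈? targets) then just ((x + w u v) ⊓∞ bound σ) else bound σ

  IsPruned : Weights → Vertex → Carrier → State → Vertex → Set
  IsPruned w u x σ v = (x + w u v) >∞ newBound w u x σ v ⊎ P < x + w u v

  isPruned? : ∀ w u x σ v → Dec (IsPruned w u x σ v)
  isPruned? w u x σ v = ((x + w u v) >∞? newBound w u x σ v) ⊎-dec (P <? (x + w u v))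

  bound-if : ∀ b {σ τ} → bound σ ≡ bound τ → bound (if b then σ else τ) ≡ bound τ
  bound-if true  eq = eq
  bound-if false eq = ≡.refl

  scanEdge-bound : ∀ w u x σ v → bound (scanEdge w u x σ v) ≡ newBound w u x σ v
  scanEdge-bound w u x σ v = bound-if (does (isPruned? w u x σ v)) ≡.refl

  -- The test of `scanEdge` is abstracted to an arbitrary decision, so that it can be matched on
  -- without unfolding the search.
  pruned-if : ∀ {A : Set} (A? : Dec A) {σ τ e f} → pruned σ ≡ f ∷ pruned τ →
    (e ∈ˡ pruned (if does A? then σ else τ) → e ∈ˡ pruned τ ⊎ (e ≡ f × A)) ×
    (e ∈ˡ pruned τ ⊎ (e ≡ f × A) → e ∈ˡ pruned (if does A? then σ else τ))
  pruned-if {A} (yes a) {σ} {τ} {e} {f} eq =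
    (λ e∈σ → to (≡.subst (e ∈ˡ_) eq e∈σ)) , λ e∈ → ≡.subst (e ∈ˡ_) (≡.sym eq) (from e∈)
    where
    to : e ∈ˡ f ∷ pruned τ → e ∈ˡ pruned τ ⊎ (e ≡ f × A)
    to (here e≡f)  = inj₂ (e≡f , a)
    to (there e∈τ) = inj₁ e∈τ
    from : e ∈ˡ pruned τ ⊎ (e ≡ f × A) → e ∈ˡ f ∷ pruned τ
    from (inj₁ e∈τ)       = there e∈τ
    from (inj₂ (e≡f , _)) = here e≡f
  pruned-if (no ¬a) eq = inj₁ , λ { (inj₁ e∈τ) → e∈τ ; (inj₂ (_ , a)) → contradiction a ¬a }

  scanEdge-pruned : ∀ w u x σ v {e} →
    (e ∈ˡ pruned (scanEdge w u x σ v) → e ∈ˡ pruned σ ⊎ (e ≡ (u , v) × IsPruned w u x σ v)) ×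
    (e ∈ˡ pruned σ ⊎ (e ≡ (u , v) × IsPruned w u x σ v) → e ∈ˡ pruned (scanEdge w u x σ v))
  scanEdge-pruned w u x σ v = pruned-if (isPruned? w u x σ v) ≡.refl

  scan-keeps : ∀ w u x vs σ {e} → e ∈ˡ pruned σ → e ∈ˡ pruned (foldl (scanEdge w u x) σ vs)
  scan-keeps w u x []       σ e∈ = e∈
  scan-keeps w u x (v ∷ vs) σ e∈ =
    scan-keeps w u x vs (scanEdge w u x σ v) (proj₂ (scanEdge-pruned w u x σ v) (inj₁ e∈))

  scan-prunes : ∀ w u x vs σ {v} → v ∈ˡ vs → P < x + w u v → (u , v) ∈ˡ pruned (foldl (scanEdge w u x) σ vs)
  scan-prunes w u x (v ∷ vs) σ (here ≡.refl) P<tent =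
    scan-keeps w u x vs (scanEdge w u x σ v) (proj₂ (scanEdge-pruned w u x σ v) (inj₂ (≡.refl , inj₂ P<tent)))
  scan-prunes w u x (v′ ∷ vs) σ (there v∈vs) P<tent = scan-prunes w u x vs (scanEdge w u x σ v′) v∈vs P<tent

  removeAndScan-keeps : ∀ w u x σ {e} → e ∈ˡ pruned σ → e ∈ˡ pruned (removeAndScan w u x σ)
  removeAndScan-keeps w u x σ = scan-keeps w u x (out u) (record σ { removed = removed σ ∪ₛ ⁅ u ⁆ })

  removeAndScan-prunes : ∀ w u x σ {v y} → x ≈ y → v ∈ˡ out u → P < y + w u v → (u , v) ∈ˡ pruned (removeAndScan w u x σ)
  removeAndScan-prunes w u x σ x≈y v∈ P< = scan-prunes w u x (out u) (record σ { removed = removed σ ∪ₛ ⁅ u ⁆ }) v∈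
    (<-≤-trans P< (≤-reflexive (+-congʳ (sym x≈y))))

  run-keeps : ∀ {w d us τ e} σ → Run w d σ us τ → e ∈ˡ pruned σ → e ∈ˡ pruned τ
  run-keeps {w} σ (stop {u = u} {x = x} _ _ _)       e∈ = removeAndScan-keeps w u x σ e∈
  run-keeps {w} σ (step {u = u} {x = x} _ _ _ later) e∈ =
    run-keeps (removeAndScan w u x σ) later (removeAndScan-keeps w u x σ e∈)

  -- Every vertex of `us` has its edges scanned, the final target included, and an entry of `pruned`
  -- is never lost afterwards. The bound is irrelevant once `P` is exceeded.
  run-prunes : ∀ {w d us τ u v} σ → Run w d σ us τ → u ∈ˡ us → v ∈ˡ out u → P < d u + w u v → (u , v) ∈ˡ pruned τ
  run-prunes {w} σ (stop {u = u} {x = x} _ x≈d _)       (here ≡.refl) v∈ P< = removeAndScan-prunes w u x σ x≈d v∈ P<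
  run-prunes {w} σ (step {u = u} {x = x} _ x≈d _ later) (here ≡.refl) v∈ P< =
    run-keeps (removeAndScan w u x σ) later (removeAndScan-prunes w u x σ x≈d v∈ P<)
  run-prunes {w} σ (step {u = u} {x = x} _ _ _ later)   (there u∈)    v∈ P< = run-prunes (removeAndScan w u x σ) later u∈ v∈ P<

  run-nonempty : ∀ {w d σ τ} → ¬ Run w d σ [] τ
  run-nonempty ()

  -- Inversion in a form that applies to a whole family of runs, one for each outcome: the key
  -- becomes a function of the outcome, and the remaining list tells the two constructors apart.
  run-head : ∀ {w d σ u us τ} → Run w d σ (u ∷ us) τ →
    ∃[ x ] x ≈ d u × ((us ≡ [] × removeAndScan w u x σ ≡ τ) ⊎ Run w d (removeAndScan w u x σ) us τ)
  run-head (stop {x = x} _ x≈d _)       = x , x≈d , inj₁ (≡.refl , ≡.refl)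
  run-head (step {x = x} _ x≈d _ later) = x , x≈d , inj₂ later

-- Measurability of pruning.

module PrunedEvents (em : ExcludedMiddle 0ℓ) {ℝ : CompleteOrderedField} (𝒫 : ProbabilitySpace ℝ)
                    {n : ℕ} (G : Network n) {D P θ : CompleteOrderedField.Carrier ℝ}
                    (M : PartialRandomModel 𝒫 G D P θ) where
  open CompleteOrderedField ℝ hiding (zero)
  open OrderedField em ℝ
  open ProbabilitySpace 𝒫
  open Probability 𝒫
  open Measure em 𝒫
  open Network G
  open Search ℝ G
  open DijkstraPrediction P
  open Pruning em ℝ G P
  open PartialRandomModel M
  open Analysis ℝ using (ray)

  -- The bound may be infinite, so it is observed through comparisons with real variables. The keys
  -- need no tracking, since `Q` and the adjacency lists fix the order of scanning and `d` the
  -- distances.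
  record StateMeasurable (σ : Ω → State) : Set₁ where
    field
      above-bound : ∀ {Z} → RayMeasurable Z → Measurable (λ ω → Z ω >∞ bound (σ ω))
      is-pruned   : ∀ e → Measurable (λ ω → e ∈ˡ pruned (σ ω))
  open StateMeasurable

  initial-measurable : StateMeasurable (λ _ → initial)
  initial-measurable = record
    { above-bound = λ _ → ≐-closed ((λ ()) , λ { (_ , () , _) }) ∅-closed
    ; is-pruned   = λ e → ≐-closed ((λ ()) , λ ()) ∅-closed
    }

  ifBound-measurable : ∀ b {σ Y Z} → StateMeasurable σ → RayMeasurable Y → RayMeasurable Z →
    Measurable (λ ω → Z ω >∞ (if b then just (Y ω ⊓∞ bound (σ ω)) else bound (σ ω)))
  ifBound-measurable false mσ mY mZ = above-bound mσ mZ
  ifBound-measurable true  mσ mY mZ =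
    ≐-closed (proj₂ >∞-⊓∞ , proj₁ >∞-⊓∞) (∪-closed (<-measurable mY mZ) (above-bound mσ mZ))

  scanEdge-measurable : ∀ {u v} {x : Ω → Carrier} {σ : Ω → State} → StateMeasurable σ →
    RayMeasurable (λ ω → x ω + weights ω u v) →
    StateMeasurable (λ ω → scanEdge (weights ω) u (x ω) (σ ω) v)
  scanEdge-measurable {u} {v} {x} {σ} mσ mY = record
    { above-bound = λ {Z} mZ → ≐-closed
        ((λ {ω} → ≡.subst (Z ω >∞_) (≡.sym (scanEdge-bound (weights ω) u (x ω) (σ ω) v))) ,
         λ {ω} → ≡.subst (Z ω >∞_) (scanEdge-bound (weights ω) u (x ω) (σ ω) v))
        (newBound-measurable mZ)
    ; is-pruned = λ e → ≐-closed
        ((λ {ω} → proj₂ (scanEdge-pruned (weights ω) u (x ω) (σ ω) v)) ,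
         λ {ω} → proj₁ (scanEdge-pruned (weights ω) u (x ω) (σ ω) v))
        (∪-closed (is-pruned mσ e) (∩-closed (const-closed (e ≡ (u , v)))
          (∪-closed (newBound-measurable mY) (<-measurable (rayMeasurable-const λ _ _ → refl) mY))))
    }
    where
    newBound-measurable : ∀ {Z} → RayMeasurable Z → Measurable (λ ω → Z ω >∞ newBound (weights ω) u (x ω) (σ ω) v)
    newBound-measurable = ifBound-measurable (does (v ∈? targets)) mσ mY

  scan-measurable : ∀ {u} {x : Ω → Carrier} vs {σ : Ω → State} → StateMeasurable σ →
    (∀ {v} → v ∈ˡ vs → RayMeasurable (λ ω → x ω + weights ω u v)) →
    StateMeasurable (λ ω → foldl (scanEdge (weights ω) u (x ω)) (σ ω) vs)
  scan-measurable []       mσ mY = mσ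
  scan-measurable (v ∷ vs) mσ mY = scan-measurable vs (scanEdge-measurable mσ (mY (here ≡.refl))) (mY ∘ there)

  removeAndScan-measurable : ∀ {u} {x : Ω → Carrier} {σ : Ω → State} → StateMeasurable σ →
    (∀ {v} → v ∈ˡ out u → RayMeasurable (λ ω → x ω + weights ω u v)) →
    StateMeasurable (λ ω → removeAndScan (weights ω) u (x ω) (σ ω))
  removeAndScan-measurable {u} mσ = scan-measurable (out u)
    (record { above-bound = above-bound mσ ; is-pruned = is-pruned mσ })

  stateMeasurable-cong : ∀ {σ τ : Ω → State} → (∀ ω → σ ω ≡ τ ω) → StateMeasurable σ → StateMeasurable τ
  stateMeasurable-cong σ≡τ mσ = record
    { above-bound = λ {Z} mZ → ≐-closed
        ((λ {ω} → ≡.subst (λ ρ → Z ω >∞ bound ρ) (σ≡τ ω)) , λ {ω} → ≡.subst (λ ρ → Z ω >∞ bound ρ) (≡.sym (σ≡τ ω)))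
        (above-bound mσ mZ)
    ; is-pruned = λ e → ≐-closed
        ((λ {ω} → ≡.subst (λ ρ → e ∈ˡ pruned ρ) (σ≡τ ω)) , λ {ω} → ≡.subst (λ ρ → e ∈ˡ pruned ρ) (≡.sym (σ≡τ ω)))
        (is-pruned mσ e)
    }

  tentative-measurable : ∀ u v → IsEdge (u , v) → RayMeasurable (tentative (u , v))
  tentative-measurable u v uv∈E with em {(u , v) ∈ˡ L_θ}
  ... | yes e∈L = λ a → IsUniform.isRandomVariable (uniform u v e∈L) (_≤ a) (ray a)
  ... | no  e∉L = rayMeasurable-const λ ω ω′ → +-congˡ (others-fixed u v uv∈E e∉L ω ω′)

  run-measurable : ∀ us {σ τ : Ω → State} → StateMeasurable σ →
    (∀ ω → Run (weights ω) d (σ ω) us (τ ω)) → StateMeasurable τ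
  run-measurable [] mσ runs = ⊥-elim (run-nonempty (runs nonempty))
  run-measurable (u ∷ us) {σ} {τ} mσ runs = continue us λ ω → proj₂ (proj₂ (run-head (runs ω)))
    where
    x : Ω → Carrier
    x ω = proj₁ (run-head (runs ω))
    scanned : Ω → State
    scanned ω = removeAndScan (weights ω) u (x ω) (σ ω)
    x≈d : ∀ ω → x ω ≈ d u
    x≈d ω = proj₁ (proj₂ (run-head (runs ω)))
    mScanned : StateMeasurable scanned
    mScanned = removeAndScan-measurable {u} {x} {σ} mσ λ {v} v∈ →
      rayMeasurable-cong {tentative (u , v)} {λ ω → x ω + weights ω u v}
        (λ ω → +-congʳ (sym (x≈d ω))) (tentative-measurable u v v∈)
    -- Matching on the list decides for all outcomes at once whether the runs stop here.
    continue : ∀ us → (∀ ω → (us ≡ [] × scanned ω ≡ τ ω) ⊎ Run (weights ω) d (scanned ω) us (τ ω)) → StateMeasurable τ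
    continue []         rest = stateMeasurable-cong {scanned} {τ} (λ ω → [ proj₂ , (λ ()) ]′ (rest ω)) mScanned
    continue (u′ ∷ us′) rest = run-measurable (u′ ∷ us′) {scanned} {τ} mScanned λ ω →
      [ (λ { (() , _) }) , (λ later → later) ]′ (rest ω)

  pruned-measurable : ∀ e → Measurable (λ ω → e ∈ˡ pruned (final ω))
  pruned-measurable = is-pruned (run-measurable Q {λ _ → initial} {final} initial-measurable run)

-- The expectation and the tail of the number of pruned edges.

module DijkstraPruning (em : ExcludedMiddle 0ℓ) {ℝ : CompleteOrderedField} (𝒫 : ProbabilitySpace ℝ)
                       {n : ℕ} (G : Network n) {D ε γ : CompleteOrderedField.Carrier ℝ} where
  open CompleteOrderedField ℝ hiding (zero)
  open Analysis ℝ
  open RingSolving ℝ using (solve; con; num; _:+_; _:*_; _:-_; :-_; _:=_)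
  open OrderedField em ℝ
  open Limits em ℝ using (ceiling)
  open NegativeExponent em ℝ using (exp-neg-<)
  open ChernoffFactor em ℝ using (chernoff-factor-≤)
  open ProbabilitySpace 𝒫
  open Probability 𝒫
  open Measure em 𝒫
  open Network G
  open Counting em 𝒫 {Edge}
  open LowerTail em 𝒫 {Edge}

  module _ (0<ε : 0# < ε) (1<γ : 1# < γ) (M : PartialRandomModel 𝒫 G D (D + ε) ((D + γ * ε) - 1#)) where
    open PartialRandomModel M
    open Search ℝ G using (pruned)
    open PrunedEvents em 𝒫 G M using (pruned-measurable)
    open Pruning em ℝ G (D + ε) using (run-prunes)

    P p : Carrier
    P = D + ε
    p = 1# - γ ⁻¹

    0<γ : 0# < γ
    0<γ = ≤-<-trans 0≤1 1<γ

    0≤γ⁻¹ : 0# ≤ γ ⁻¹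
    0≤γ⁻¹ = <⇒≤ (⁻¹-pos 0<γ)

    0≤p : 0# ≤ p
    0≤p = x≤y⇒0≤y-x (*-cancel-≤ 0<γ (≤-respˡ-≈ (sym (⁻¹-inverse 0<γ)) (≤-respʳ-≈ (sym (*-identityʳ γ)) (<⇒≤ 1<γ))))

    p≤1 : p ≤ 1#
    p≤1 = difference 0≤γ⁻¹ (solve 1 (λ g → g := con (+ 1) :- (con (+ 1) :- g)) refl (γ ⁻¹))

    ℙ-exceeds : ∀ {e} → e ∈ˡ L_θ → p ≤ ℙ (Exceeds tentative P e)
    ℙ-exceeds {u , v} e∈L = ≤-respʳ-≈ (sym (ℙ-∁ (isRandomVariable (_≤ P) (ray P))))
      (+-mono-≤ ≤-refl (-‿anti-≤ (≤-respˡ-≈ (sym (distribution P D≤P P≤end))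
        (*-cancel-≤ 0<ℓ (≤-respˡ-≈ (sym ℓεℓ⁻¹≈ε) ε≤ℓγ⁻¹)))))
      where
      open IsUniform (uniform u v e∈L)
      ℓ = d u + 1# - D
      -- Relevance is stated for each outcome, but this part of it concerns only fixed quantities
      -- and may be read off at any one.
      θ≤d : (D + γ * ε) - 1# ≤ d u
      θ≤d = proj₁ (proj₂ (proj₂ (Equivalence.to (L_θ-relevant nonempty (u , v)) e∈L)))
      γε≤ℓ : γ * ε ≤ ℓ
      γε≤ℓ = difference (x≤y⇒0≤y-x θ≤d)
        (solve 3 (λ δ D z → δ :- ((D :+ z) :- con (+ 1)) := (δ :+ con (+ 1) :- D) :- z) refl (d u) D (γ * ε))
      0<ℓ : 0# < ℓ
      0<ℓ = <-≤-trans (*-pos 0<γ 0<ε) γε≤ℓ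
      D≤P : D ≤ P
      D≤P = difference (<⇒≤ 0<ε) (solve 2 (λ D ε → ε := (D :+ ε) :- D) refl D ε)
      -- The distribution function is known only on the interval; `P` lies in it because
      -- `ε ≤ γε ≤ ℓ`.
      P≤end : P ≤ d u + 1#
      P≤end = difference (+-nonneg (x≤y⇒0≤y-x γε≤ℓ) (*-nonneg (x≤y⇒0≤y-x (<⇒≤ 1<γ)) (<⇒≤ 0<ε)))
        (solve 4 (λ δ D ε γ → ((δ :+ con (+ 1) :- D) :- γ :* ε) :+ (γ :- con (+ 1)) :* ε := (δ :+ con (+ 1)) :- (D :+ ε)) refl
          (d u) D ε γ)
      ℓεℓ⁻¹≈ε : ℓ * ((P - D) * ℓ ⁻¹) ≈ ε
      ℓεℓ⁻¹≈ε = trans (solve 4 (λ ℓ D ε i → ℓ :* (((D :+ ε) :- D) :* i) := (ℓ :* i) :* ε) refl ℓ D ε (ℓ ⁻¹))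
        (trans (*-congʳ (⁻¹-inverse 0<ℓ)) (*-identityˡ ε))
      ε≤ℓγ⁻¹ : ε ≤ ℓ * γ ⁻¹
      ε≤ℓγ⁻¹ = ≤-respˡ-≈
        (trans (solve 3 (λ γ ε i → (γ :* ε) :* i := (γ :* i) :* ε) refl γ ε (γ ⁻¹))
          (trans (*-congʳ (⁻¹-inverse 0<γ)) (*-identityˡ ε)))
        (*-mono-≤ (*-nonneg (<⇒≤ 0<γ) (<⇒≤ 0<ε)) γε≤ℓ 0≤γ⁻¹ ≤-refl)

    tentative-isRandomVariable : AllMeasurable L_θ tentative
    tentative-isRandomVariable {u , v} e∈L = IsUniform.isRandomVariable (uniform u v e∈L)

    indicator-0-or-1 : ∀ {A : Set} (A? : Dec A) → (if does A? then 1 else 0) ≡ 0 ⊎ (if does A? then 1 else 0) ≡ 1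
    indicator-0-or-1 (yes _) = inj₂ ≡.refl
    indicator-0-or-1 (no  _) = inj₁ ≡.refl

    indicator≡1 : ∀ {A : Set} (A? : Dec A) → (A → (if does A? then 1 else 0) ≡ 1) × ((if does A? then 1 else 0) ≡ 1 → A)
    indicator≡1 (yes a) = (λ _ → ≡.refl) , λ _ → a
    indicator≡1 (no ¬a) = (λ a → contradiction a ¬a) , λ ()

    pruned? : ∀ e ω → Dec (e ∈ˡ pruned (final ω))
    pruned? e ω = member? _≟ₑ_ e (pruned (final ω))

    prunedIndicator-0-or-1 : ∀ e ω → prunedIndicator e ω ≡ 0 ⊎ prunedIndicator e ω ≡ 1
    prunedIndicator-0-or-1 e ω = indicator-0-or-1 (pruned? e ω)

    prunedIndicator-measurable : OnMeasurable prunedIndicator prunedIndicator-0-or-1 L_θ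
    prunedIndicator-measurable {e} _ = ≐-closed
      ((λ {ω} → proj₁ (indicator≡1 (pruned? e ω))) , λ {ω} → proj₂ (indicator≡1 (pruned? e ω))) (pruned-measurable e)

    exceeds⇒pruned : ∀ {e} → e ∈ˡ L_θ → ∀ {ω} → Exceeds tentative P e ω → prunedIndicator e ω ≡ 1
    exceeds⇒pruned {u , v} e∈L {ω} P<tent =
      let uv∈E , u∈Q , _ = Equivalence.to (L_θ-relevant ω (u , v)) e∈L
      in proj₁ (indicator≡1 (pruned? (u , v) ω)) (run-prunes (Search.initial ℝ G) (run ω) u∈Q uv∈E (≰⇒> P<tent))

    expectation-≥ : ∃[ μ ] IsExpectation X μ × p * fromℕ (length L_θ) ≤ μ
    expectation-≥ =
      moment prunedIndicator prunedIndicator-0-or-1 L_θ (suc (length L_θ)) ,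
      count-expectation prunedIndicator prunedIndicator-0-or-1 L_θ prunedIndicator-measurable ,
      moment-≥ prunedIndicator prunedIndicator-0-or-1 L_θ prunedIndicator-measurable λ {e} e∈L → ≤-trans (ℙ-exceeds e∈L)
        (ℙ-mono (tentative-isRandomVariable e∈L _ (complement (ray P))) (prunedIndicator-measurable e∈L)
          λ {ω} → exceeds⇒pruned e∈L {ω})

    exceedances≤X : ∀ ω → exceedances tentative P L_θ ω ℕ.≤ X ω
    exceedances≤X ω = go L_θ (λ e∈ → e∈)
      where
      exceeds≤ : ∀ {e} → e ∈ˡ L_θ → exceeds tentative P e ω ℕ.≤ prunedIndicator e ω
      exceeds≤ {e} e∈L = [ (λ eq → ℕ.≤-trans (ℕ.≤-reflexive eq) ℕ.z≤n) ,
        (λ eq → ℕ.≤-reflexive (≡.trans eq (≡.sym (exceeds⇒pruned e∈L (proj₁ (exceeds⇔ tentative P) eq))))) ]′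
        (exceeds-0-or-1 tentative P e ω)
      go : ∀ es → (∀ {e} → e ∈ˡ es → e ∈ˡ L_θ) →
        exceedances tentative P es ω ℕ.≤ count prunedIndicator prunedIndicator-0-or-1 es ω
      go []       es⊆ = ℕ.z≤n
      go (e ∷ es) es⊆ = ℕ.+-mono-≤ (exceeds≤ (es⊆ (here ≡.refl))) (go es (es⊆ ∘ there))

    m h q : Carrier
    m = p * fromℕ (length L_θ)
    h = fromℕ 2 ⁻¹
    q = p * fromℕ 8 ⁻¹

    8q≈p : fromℕ 8 * q ≈ p
    8q≈p = trans (solve 3 (λ e p i → e :* (p :* i) := (e :* i) :* p) refl (fromℕ 8) p (fromℕ 8 ⁻¹))
      (trans (*-congʳ (⁻¹-inverse (fromℕ-pos 7))) (*-identityˡ p))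

    0≤q : 0# ≤ q
    0≤q = *-nonneg 0≤p (<⇒≤ (⁻¹-pos (fromℕ-pos 7)))

    2hm≈m : fromℕ 2 * (h * m) ≈ m
    2hm≈m = trans (sym (*-assoc (fromℕ 2) h m)) (trans (*-congʳ (⁻¹-inverse (fromℕ-pos 1))) (*-identityˡ m))

    0≤hm : 0# ≤ h * m
    0≤hm = *-nonneg (<⇒≤ (⁻¹-pos (fromℕ-pos 1))) (*-nonneg 0≤p (fromℕ-nonneg (length L_θ)))

    Many : Pred Ω 0ℓ
    Many ω = h * m ≤ fromℕ (X ω)

    many-measurable : Measurable Many
    many-measurable = count-measurable prunedIndicator prunedIndicator-0-or-1 L_θ prunedIndicator-measurable
      (λ k → h * m ≤ fromℕ k)

    -- The conjunct `U` is the trivial initial event `C` of `lower-tail`.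
    Few : ℕ → Pred Ω 0ℓ
    Few r ω = U ω × exceedances tentative P L_θ ω ℕ.≤ r

    few-measurable : ∀ r → Measurable (Few r)
    few-measurable r = ∩-closed universe (count-measurable (exceeds tentative P) (exceeds-0-or-1 tentative P) L_θ
      (exceeds-measurable tentative P L_θ tentative-isRandomVariable) (ℕ._≤ r))

    independentOf-U : IndependentOf tentative U L_θ
    independentOf-U S bS = trans
      (ℙ-respects (∩-closed universe (allEvent-measurable tentative L_θ tentative-isRandomVariable bS)) (proj₂ , (_ ,_)))
      (trans (independent S bS) (sym (trans (*-congʳ ℙ-universe) (*-identityˡ _))))

    ℙ-few-≤ : ∀ r → ℙ (Few r) ≤ fromℕ 2 ^ r * (1# - fromℕ 4 * q) ^ length L_θ
    ℙ-few-≤ r = ≤-respʳ-≈ (*-congˡ (trans (*-congʳ ℙ-universe) (*-identityˡ _)))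
      -- The parameter `s` is `4q`, half of `p`.
      (lower-tail tentative P (*-nonneg (fromℕ-nonneg 4) 0≤q) 4q≤1 L_θ U r universe tentative-isRandomVariable L_θ-unique
        independentOf-U λ e∈L → ≤-respˡ-≈ (sym 2[4q]≈p) (ℙ-exceeds e∈L))
      where
      2[4q]≈p : fromℕ 2 * (fromℕ 4 * q) ≈ p
      2[4q]≈p = trans (solve 1 (λ q → num 2 :* (num 4 :* q) := num 8 :* q) refl q) 8q≈p
      4q≤1 : fromℕ 4 * q ≤ 1#
      4q≤1 = ≤-trans (difference (*-nonneg (fromℕ-nonneg 4) 0≤q)
        (trans (solve 1 (λ q → num 4 :* q := num 8 :* q :- num 4 :* q) refl q) (+-congʳ 8q≈p))) p≤1

    -- The natural number is the ceiling of half of `m`. If it is `suc r`, missing the threshold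
    -- leaves at most `r` exceedances, and `r` is at most half of `m`, as `chernoff-factor-≤`
    -- requires; if it is zero, every outcome meets the threshold.
    ℙ-many-≥ : ∀ {x} → 0# ≤ x → IsExp x (fromℕ n) → 0# < fromℕ n → fromℕ 8 * x ≤ m →
      ∃[ k ] h * m ≤ fromℕ k × fromℕ k < h * m + 1# → 1# - fromℕ n ⁻¹ ≤ ℙ Many
    ℙ-many-≥ _ _ 0<n _ (zero , hm≤0 , _) = ≤-trans
      (difference (<⇒≤ (⁻¹-pos 0<n)) (solve 1 (λ i → i := con (+ 1) :- (con (+ 1) :- i)) refl (fromℕ n ⁻¹)))
      (≤-respˡ-≈ ℙ-universe (ℙ-mono universe many-measurable λ {ω} _ → ≤-trans hm≤0 (fromℕ-nonneg (X ω))))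
    ℙ-many-≥ {x} 0≤x isExp 0<n 8x≤m (suc r , hm≤1+r , 1+r<hm+1) = ≤-trans
      (+-mono-≤ ≤-refl (-‿anti-≤ (≤-trans (ℙ-few-≤ r)
        (*-cancel-≤ 0<n (≤-respʳ-≈ (sym (⁻¹-inverse 0<n))
          (chernoff-factor-≤ N r isExp 0≤x (<⇒≤ 0<n) 0≤q (≤-trans (≤-reflexive 8q≈p) p≤1) x≤Nq 2r≤8qN))))))
      (≤-respˡ-≈ (ℙ-∁ (few-measurable r)) (ℙ-mono (∁-closed (few-measurable r)) many-measurable
        λ {ω} ¬few → ≤-trans hm≤1+r (fromℕ-mono (ℕ.≤-trans (ℕ.≰⇒> λ few → ¬few (_ , few)) (exceedances≤X ω)))))
      where
      N = length L_θ
      8qN≈m : fromℕ 8 * q * fromℕ N ≈ m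
      8qN≈m = *-congʳ 8q≈p
      x≤Nq : x ≤ fromℕ N * q
      x≤Nq = *-cancel-≤ (fromℕ-pos 7) (≤-trans 8x≤m (≤-reflexive (trans (sym 8qN≈m)
        (solve 3 (λ e q ν → e :* q :* ν := e :* (ν :* q)) refl (fromℕ 8) q (fromℕ N)))))
      2r≤8qN : fromℕ 2 * fromℕ r ≤ fromℕ 8 * q * fromℕ N
      2r≤8qN = ≤-respʳ-≈ (trans 2hm≈m (sym 8qN≈m)) (*-monoˡ-≤ (fromℕ 2) (fromℕ-nonneg 2)
        (difference (x≤y⇒0≤y-x (<⇒≤ 1+r<hm+1))
          (solve 2 (λ a ρ → (a :+ con (+ 1)) :- (con (+ 1) :+ ρ) := a :- ρ) refl (h * m) (fromℕ r))))

    tail-≥ : ∀ ln-n → IsLn (fromℕ n) ln-n → fromℕ 8 * ln-n ≤ m → 1# - fromℕ n ⁻¹ ≤ ℙ Many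
    tail-≥ x isLn 8x≤m = byCardinality n source ≡.refl
      where
      -- `source` excludes `n = 0`. The value of `n` is compared through an equation because `G`
      -- depends on `n`. For `n = 1` the lower bound is zero; from 2 on, `exp-neg-<` yields that the
      -- logarithm is nonnegative.
      byCardinality : ∀ k → Fin k → n ≡ k → 1# - fromℕ n ⁻¹ ≤ ℙ Many
      byCardinality (suc zero) _ n≡1 = ≤-trans (≤-reflexive (trans
          (+-congˡ (-‿cong (trans (reflexive (≡.cong (λ k → fromℕ k ⁻¹) n≡1)) 1⁻¹≈1))) (-‿inverseʳ 1#)))
        (ℙ-nonneg many-measurable)
        where
        1⁻¹≈1 : fromℕ 1 ⁻¹ ≈ 1#
        1⁻¹≈1 = trans (solve 1 (λ i → i := num 1 :* i) refl (fromℕ 1 ⁻¹)) (⁻¹-inverse (fromℕ-pos 0))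
      byCardinality (suc (suc k)) _ n≡2+k = ℙ-many-≥ 0≤x isLn
        (≡.subst (λ j → 0# < fromℕ j) (≡.sym n≡2+k) (fromℕ-pos (suc k))) 8x≤m (ceiling 0≤hm)
        where
        0≤x : 0# ≤ x
        0≤x = ≮⇒≥ λ x<0 → <⇒≱ (exp-neg-< isLn x<0)
          (≡.subst (λ j → fromℕ 2 ≤ fromℕ j) (≡.sym n≡2+k) (fromℕ-mono {2} {suc (suc k)} (ℕ.s≤s (ℕ.s≤s ℕ.z≤n))))

theorem2 :
  ExcludedMiddle 0ℓ →
  (ℝ : CompleteOrderedField) (𝒫 : ProbabilitySpace ℝ) →
  let open CompleteOrderedField ℝ
      open Analysis ℝ
      open ProbabilitySpace 𝒫
      open Probability 𝒫
  in
  (n : ℕ) (G : Network n) (D ε γ : Carrier) →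
  0# < ε → ε < 1# →
  1# < γ → γ ≤ ε ⁻¹ →
  (M : PartialRandomModel 𝒫 G D (D + ε) ((D + γ * ε) - 1#)) →
  let open PartialRandomModel M
      m = (1# - γ ⁻¹) * fromℕ (length L_θ)
  in
  (∃[ μ ] IsExpectation X μ × m ≤ μ) ×
  (∀ ln-n → IsLn (fromℕ n) ln-n → fromℕ 8 * ln-n ≤ m →
    1# - fromℕ n ⁻¹ ≤ ℙ (λ ω → fromℕ 2 ⁻¹ * m ≤ fromℕ (X ω)))
theorem2 em ℝ 𝒫 n G D ε γ 0<ε _ 1<γ _ M = expectation-≥ 0<ε 1<γ M , tail-≥ 0<ε 1<γ M
  where open DijkstraPruning em 𝒫 G
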